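{- Let $\mathcal C$ be a cartesian $R$-differential category, where $R$ has multiplicative inverses for integers. For all $n,i,j\in\mathbb N$ with $n\ge i$ and $n\ge j$, and all $f\in\mathcal C(X,Y)$, $$t_j(t_if)\circ(s_{n\to j}*s_{n\to i})\circ l_n=\begin{cases}t_if\circ s_{n\to i}&\text{if }i=j,\\0&\text{otherwise,}\end{cases}$$ and $l_n$ is a natural transformation $T_n\Rightarrow T_nT_n$ of functors on $\mathcal C$.
   Context: $R$ is a commutative semiring with multiplicative inverses for integers: for each integer $n\ge1$ there is $\frac1n\in R$ with $\frac1n\cdot(1_R+\cdots+1_R)=1_R$ ($n$ summands). A map between $R$-semimodules is $R$-additive if it preserves sums, $0$ and the action of $R$. A left $R$-additive category is a category $\mathcal C$ whose hom-sets are $R$-semimodules and such that every precomposition map $\_\circ f$ is $R$-additive; a morphism $h:Y\to Z$ is $R$-additive if every postcomposition map $h\circ\_:\mathcal C(X,Y)\to\mathcal C(X,Z)$ is $R$-additive. A cartesian left $R$-additive category is one with finite products whose projections are $R$-additive. $\langle\cdots\rangle$ denotes tupling. Put $SX=X\times X$ with projections $\pi_0,\pi_1:SX\to X$. A derivative is a family of operators $D:\mathcal C(X,Y)\to\mathcal C(SX,Y)$ such that: (i) $Dp=p\circ\pi_1$ for every product projection $p:X_0\times\cdots\times X_n\to X_i$; (ii) $D$ is $R$-additive; (iii) $D\,\mathrm{id}=\pi_1$ and $D(g\circ f)=Dg\circ\langle f\circ\pi_0,Df\rangle$; (iv) $Df$ is $R$-additive in its second argument, i.e. $u\mapsto Df\circ\langle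 x,u\rangle$ is $R$-additive; (v) $DDf\circ\langle\langle x,0\rangle,\langle 0,u\rangle\rangle=Df\circ\langle x,u\rangle$; (vi) $DDf\circ\langle\langle x,u\rangle,\langle v,w\rangle\rangle=DDf\circ\langle\langle x,v\rangle,\langle u,w\rangle\rangle$. A cartesian $R$-differential category is a cartesian left $R$-additive category with a derivative. $S_nX=X^{n+1}$, $S_nf=f^{n+1}$, with projections $\pi_0,\dots,\pi_n:S_nX\to X$; for $m\le n$, $s_{n\to m}=\langle\pi_0,\dots,\pi_m\rangle:S_nX\to S_mX$, and $s_{n\to j}*s_{n\to i}:S_nS_nX\to S_jS_iX$ is the horizontal composite $S_j(s_{n\to i})\circ s_{n\to j}$. For $n\ge1$, $\nu_n=\langle\langle\pi_0,\dots,\pi_{n-1}\rangle,\langle\tfrac1n\pi_1,\tfrac2n\pi_2,\dots,\tfrac nn\pi_n\rangle\rangle:S_nX\to SS_{n-1}X$. For $f\in\mathcal C(X,Y)$ define $t_nf:S_nX\to Y$ by $t_0f=f$, $t_{n+1}f=D(t_nf)\circ\nu_{n+1}$; thus $t_j(t_if):S_jS_iX\to Y$. The functor $T_n$ on $\mathcal C$ is $T_nX=S_nX$ and, for $f:X\to Y$, $\pi_i\circ T_nf=t_if\circ s_{n\to i}$ for $0\le i\le n$. The family $l_n:S_nX\to S_nS_nX$ is given by $\pi_i\circ\pi_j\circ l_n=\pi_i$ if $i=j$ and $0$ otherwise. -}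

module Defs where

open import Algebra.Bundles using (CommutativeSemiring; RawMonoid)
open import Algebra.Module.Bundles using (LeftSemimodule)
open import Algebra.Module.Structures using (IsLeftSemimodule)
open import Algebra.Module.Morphism.Structures using (module LeftSemimoduleMorphisms)
open import Data.Bool.Base using (if_then_else_)
open import Data.Fin.Base using (Fin; zero; suc; toℕ; fromℕ; inject₁; inject≤)
import Data.Fin.Properties as Fin
open import Data.Nat.Base using (ℕ; zero; suc; NonZero; _≤_; s≤s)
import Data.Nat.Properties as ℕ
open import Data.Vec.Functional using ([]; _∷_)
open import Level using (Level; _⊔_) renaming (suc to lsuc)
open import Relation.Binary.Bundles using (Setoid)
open import Relation.Binary.PropositionalEquality as ≡ using (_≡_)
open import Relation.Binary.Structures using (IsEquivalence)
import Relation.Binary.Reasoning.Setoid as SetoidReasoning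
open import Relation.Nullary.Decidable using (does)
import Algebra.Definitions.RawMonoid as RawMonoidDefinitions

private
  variable
    r ℓr o ℓ e o′ ℓ′ e′ o″ ℓ″ e″ m₁ ℓm₁ m₂ ℓm₂ : Level

------------------------------------------------------------------------
-- Categories, functors, natural transformations

record Category (o ℓ e : Level) : Set (lsuc (o ⊔ ℓ ⊔ e)) where
  infix  4 _≈_ _⇒_
  infixr 9 _∘_

  field
    Obj       : Set o
    _⇒_       : Obj → Obj → Set ℓ
    _≈_       : ∀ {X Y} → X ⇒ Y → X ⇒ Y → Set e
    id        : ∀ {X} → X ⇒ X
    _∘_       : ∀ {X Y Z} → Y ⇒ Z → X ⇒ Y → X ⇒ Z
    equiv     : ∀ {X Y} → IsEquivalence (_≈_ {X} {Y})
    ∘-cong    : ∀ {X Y Z} {g g′ : Y ⇒ Z} {f f′ : X ⇒ Y} →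
                g ≈ g′ → f ≈ f′ → g ∘ f ≈ g′ ∘ f′
    identityˡ : ∀ {X Y} (f : X ⇒ Y) → id ∘ f ≈ f
    identityʳ : ∀ {X Y} (f : X ⇒ Y) → f ∘ id ≈ f
    assoc     : ∀ {W X Y Z} (h : Y ⇒ Z) (g : X ⇒ Y) (f : W ⇒ X) →
                (h ∘ g) ∘ f ≈ h ∘ (g ∘ f)

  homSetoid : Obj → Obj → Setoid ℓ e
  homSetoid X Y = record { Carrier = X ⇒ Y ; _≈_ = _≈_ ; isEquivalence = equiv }

record Functor (C : Category o ℓ e) (D : Category o′ ℓ′ e′)
               : Set (o ⊔ ℓ ⊔ e ⊔ o′ ⊔ ℓ′ ⊔ e′) where
  private
    module C = Category C
    module D = Category D

  field
    F₀           : C.Obj → D.Obj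
    F₁           : ∀ {X Y} → X C.⇒ Y → F₀ X D.⇒ F₀ Y
    F-cong       : ∀ {X Y} {f g : X C.⇒ Y} → f C.≈ g → F₁ f D.≈ F₁ g
    identity     : ∀ {X} → F₁ (C.id {X}) D.≈ D.id
    homomorphism : ∀ {X Y Z} (g : Y C.⇒ Z) (f : X C.⇒ Y) →
                   F₁ (g C.∘ f) D.≈ F₁ g D.∘ F₁ f

infixr 9 _∘F_

_∘F_ : {C : Category o ℓ e} {D : Category o′ ℓ′ e′} {E : Category o″ ℓ″ e″} →
       Functor D E → Functor C D → Functor C E
_∘F_ {E = E} G F = record
  { F₀           = λ X → G.F₀ (F.F₀ X)
  ; F₁           = λ f → G.F₁ (F.F₁ f)
  ; F-cong       = λ p → G.F-cong (F.F-cong p)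
  ; identity     = E.trans (G.F-cong F.identity) G.identity
  ; homomorphism = λ g f →
      E.trans (G.F-cong (F.homomorphism g f)) (G.homomorphism (F.F₁ g) (F.F₁ f))
  }
  where
  module F = Functor F
  module G = Functor G
  module E {X} {Y} = IsEquivalence (Category.equiv E {X} {Y})

IsNaturalTransformation :
  {C : Category o ℓ e} {D : Category o′ ℓ′ e′} (F G : Functor C D) →
  (∀ X → Category._⇒_ D (Functor.F₀ F X) (Functor.F₀ G X)) → Set (o ⊔ ℓ ⊔ e′)
IsNaturalTransformation {C = C} {D = D} F G η =
  ∀ {X Y} (f : X ⇒ Y) → η Y ∘ Functor.F₁ F f ≈ Functor.F₁ G f ∘ η X
  where
  open Category C using (_⇒_)
  open Category D using (_∘_; _≈_)

record FiniteProducts (C : Category o ℓ e) : Set (o ⊔ ℓ ⊔ e) where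
  open Category C

  field
    Π          : ∀ {n} → (Fin n → Obj) → Obj
    proj       : ∀ {n} {A : Fin n → Obj} (i : Fin n) → Π A ⇒ A i
    ⟨_⟩        : ∀ {n} {A : Fin n → Obj} {X} → (∀ i → X ⇒ A i) → X ⇒ Π A
    proj-⟨⟩    : ∀ {n} {A : Fin n → Obj} {X} (f : ∀ i → X ⇒ A i) (i : Fin n) →
                 proj {A = A} i ∘ ⟨ f ⟩ ≈ f i
    ⟨⟩-unique  : ∀ {n} {A : Fin n → Obj} {X} (f : ∀ i → X ⇒ A i) (h : X ⇒ Π A) →
                 (∀ i → proj i ∘ h ≈ f i) → h ≈ ⟨ f ⟩

------------------------------------------------------------------------
-- Scalars

record IntegerInverses (R : CommutativeSemiring r ℓr) : Set (r ⊔ ℓr) where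
  open CommutativeSemiring R
  open RawMonoidDefinitions +-rawMonoid using (_×_)

  field
    1/_         : (n : ℕ) .{{_ : NonZero n}} → Carrier
    1/-inverseˡ : (n : ℕ) .{{_ : NonZero n}} → (1/ n) * (n × 1#) ≈ 1#

  infixl 7 _÷_

  _÷_ : ℕ → (n : ℕ) .{{_ : NonZero n}} → Carrier
  k ÷ n = (k × 1#) * (1/ n)

-- R is commutative, so R-semimodules are taken to be left semimodules.
IsAdditive : {R : CommutativeSemiring r ℓr}
             (M : LeftSemimodule (CommutativeSemiring.semiring R) m₁ ℓm₁)
             (N : LeftSemimodule (CommutativeSemiring.semiring R) m₂ ℓm₂) →
             (LeftSemimodule.Carrierᴹ M → LeftSemimodule.Carrierᴹ N) →
             Set (r ⊔ m₁ ⊔ ℓm₁ ⊔ ℓm₂)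
IsAdditive M N = IsLeftSemimoduleHomomorphism
  where
  open LeftSemimoduleMorphisms
    (LeftSemimodule.rawLeftSemimodule M) (LeftSemimodule.rawLeftSemimodule N)

------------------------------------------------------------------------
-- Cartesian differential categories

record LeftAdditiveCategory (R : CommutativeSemiring r ℓr) (o ℓ e : Level)
                            : Set (r ⊔ ℓr ⊔ lsuc (o ⊔ ℓ ⊔ e)) where
  infixl 6 _+_
  infixr 7 _·_

  field
    category : Category o ℓ e

  open Category category public

  field
    _+_              : ∀ {X Y} → X ⇒ Y → X ⇒ Y → X ⇒ Y
    𝟘                : ∀ {X Y} → X ⇒ Y
    _·_              : ∀ {X Y} → CommutativeSemiring.Carrier R → X ⇒ Y → X ⇒ Y
    isLeftSemimodule : ∀ {X Y} → IsLeftSemimodule (CommutativeSemiring.semiring R)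
                                   (_≈_ {X} {Y}) _+_ 𝟘 _·_

  Hom : Obj → Obj → LeftSemimodule (CommutativeSemiring.semiring R) ℓ e
  Hom X Y = record { isLeftSemimodule = isLeftSemimodule {X} {Y} }

  field
    precomposition-additive : ∀ {X Y Z} (f : X ⇒ Y) →
                              IsAdditive {R = R} (Hom Y Z) (Hom X Z) (_∘ f)

  IsAdditiveMorphism : ∀ {Y Z} → Y ⇒ Z → Set (r ⊔ o ⊔ ℓ ⊔ e)
  IsAdditiveMorphism {Y} {Z} h = ∀ X → IsAdditive {R = R} (Hom X Y) (Hom X Z) (h ∘_)

record CartesianLeftAdditiveCategory (R : CommutativeSemiring r ℓr) (o ℓ e : Level)
                                     : Set (r ⊔ ℓr ⊔ lsuc (o ⊔ ℓ ⊔ e)) where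
  field
    leftAdditiveCategory : LeftAdditiveCategory R o ℓ e

  open LeftAdditiveCategory leftAdditiveCategory public

  field
    finiteProducts : FiniteProducts category

  open FiniteProducts finiteProducts public

  field
    proj-additive : ∀ {n} {A : Fin n → Obj} (i : Fin n) →
                    IsAdditiveMorphism (proj {A = A} i)

  S : Obj → Obj
  S X = Π {2} (λ _ → X)

  π₀ π₁ : ∀ {X} → S X ⇒ X
  π₀ = proj zero
  π₁ = proj (suc zero)

  ⟨_,_⟩ : ∀ {W X} → W ⇒ X → W ⇒ X → W ⇒ S X
  ⟨ f , g ⟩ = ⟨ f ∷ g ∷ [] ⟩

record CartesianDifferentialCategory (R : CommutativeSemiring r ℓr) (o ℓ e : Level)
                                     : Set (r ⊔ ℓr ⊔ lsuc (o ⊔ ℓ ⊔ e)) where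
  field
    cartesianLeftAdditiveCategory : CartesianLeftAdditiveCategory R o ℓ e

  open CartesianLeftAdditiveCategory cartesianLeftAdditiveCategory public

  field
    D            : ∀ {X Y} → X ⇒ Y → S X ⇒ Y
    D-proj       : ∀ {n} {A : Fin n → Obj} (i : Fin n) →
                   D (proj {A = A} i) ≈ proj i ∘ π₁
    D-additive   : ∀ {X Y} → IsAdditive {R = R} (Hom X Y) (Hom (S X) Y) D
    D-id         : ∀ {X} → D (id {X}) ≈ π₁
    D-∘          : ∀ {X Y Z} (g : Y ⇒ Z) (f : X ⇒ Y) →
                   D (g ∘ f) ≈ D g ∘ ⟨ f ∘ π₀ , D f ⟩
    D-additive₂  : ∀ {W X Y} (f : X ⇒ Y) (x : W ⇒ X) →
                   IsAdditive {R = R} (Hom W X) (Hom W Y) (λ u → D f ∘ ⟨ x , u ⟩)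
    D-lift       : ∀ {W X Y} (f : X ⇒ Y) (x u : W ⇒ X) →
                   D (D f) ∘ ⟨ ⟨ x , 𝟘 ⟩ , ⟨ 𝟘 , u ⟩ ⟩ ≈ D f ∘ ⟨ x , u ⟩
    D-flip       : ∀ {W X Y} (f : X ⇒ Y) (x u v w : W ⇒ X) →
                   D (D f) ∘ ⟨ ⟨ x , u ⟩ , ⟨ v , w ⟩ ⟩
                     ≈ D (D f) ∘ ⟨ ⟨ x , v ⟩ , ⟨ u , w ⟩ ⟩

------------------------------------------------------------------------
-- The functors T n

module HigherTangent
  {R : CommutativeSemiring r ℓr} (inverses : IntegerInverses R)
  (𝒞 : CartesianDifferentialCategory R o ℓ e) where

  open CartesianDifferentialCategory 𝒞 public
  open IntegerInverses inverses public

  -- The unary power is X itself, so that t 0 f = f is well typed.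
  Sₙ : ℕ → Obj → Obj
  Sₙ zero    X = X
  Sₙ (suc n) X = Π {suc (suc n)} (λ _ → X)

  π : ∀ n {X} → Fin (suc n) → Sₙ n X ⇒ X
  π zero    _ = id
  π (suc n) i = proj i

  tuple : ∀ n {W X} → (Fin (suc n) → W ⇒ X) → W ⇒ Sₙ n X
  tuple zero    f = f zero
  tuple (suc n) f = ⟨ f ⟩

  Sₙ₁ : ∀ n {X Y} → X ⇒ Y → Sₙ n X ⇒ Sₙ n Y
  Sₙ₁ n f = tuple n (λ i → f ∘ π n i)

  s : ∀ {m n X} → .(m ≤ n) → Sₙ n X ⇒ Sₙ m X
  s {m} {n} m≤n = tuple m (λ i → π n (inject≤ i (s≤s m≤n)))

  -- The horizontal composite of s : Sₙ n ⇒ Sₙ j with s : Sₙ n ⇒ Sₙ i.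
  s*s : ∀ {i j n X} → .(j ≤ n) → .(i ≤ n) → Sₙ n (Sₙ n X) ⇒ Sₙ j (Sₙ i X)
  s*s {i} {j} {n} {X} j≤n i≤n =
    Sₙ₁ j (s {i} {n} {X} i≤n) ∘ s {j} {n} {Sₙ n X} j≤n

  -- ν n is usually written with index n + 1.
  ν : ∀ n {X} → Sₙ (suc n) X ⇒ S (Sₙ n X)
  ν n = ⟨ tuple n (λ i → π (suc n) (inject₁ i))
        , tuple n (λ i → (suc (toℕ i) ÷ suc n) · π (suc n) (suc i)) ⟩

  t : ∀ n {X Y} → X ⇒ Y → Sₙ n X ⇒ Y
  t zero    f = f
  t (suc n) f = D (t n f) ∘ ν n

  Tₙ₁ : ∀ n {X Y} → X ⇒ Y → Sₙ n X ⇒ Sₙ n Y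
  Tₙ₁ n {X} f = tuple n (λ i → t (toℕ i) f ∘ s {n = n} {X} (Fin.toℕ≤pred[n] i))

  l : ∀ n {X} → Sₙ n X ⇒ Sₙ n (Sₙ n X)
  l n = tuple n (λ j → tuple n (λ i → if does (i Fin.≟ j) then π n i else 𝟘))

  ----------------------------------------------------------------------
  -- Functoriality of Tₙ₁ n

  private
    module ≈ {X} {Y} = IsEquivalence (equiv {X} {Y})
    module R = CommutativeSemiring R
    module Mod {X} {Y} = IsLeftSemimodule (isLeftSemimodule {X} {Y})
    module Add {X Y Z W} {M : X ⇒ Y → Z ⇒ W}
               (h : IsAdditive {R = R} (Hom X Y) (Hom Z W) M) =
      LeftSemimoduleMorphisms.IsLeftSemimoduleHomomorphism h
    module ≈-Reasoning {X} {Y} = SetoidReasoning (homSetoid X Y)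
    open ≈-Reasoning
    open RawMonoidDefinitions R.+-rawMonoid using (_×_)

    infixl 9 _⟨∘_
    infixr 9 _∘⟩_

    _⟨∘_ : ∀ {X Y Z} {g g′ : Y ⇒ Z} → g ≈ g′ → (f : X ⇒ Y) → g ∘ f ≈ g′ ∘ f
    p ⟨∘ f = ∘-cong p ≈.refl

    _∘⟩_ : ∀ {X Y Z} (g : Y ⇒ Z) {f f′ : X ⇒ Y} → f ≈ f′ → g ∘ f ≈ g ∘ f′
    g ∘⟩ p = ∘-cong ≈.refl p

  π-tuple : ∀ n {W X} (f : Fin (suc n) → W ⇒ X) i → π n i ∘ tuple n f ≈ f i
  π-tuple zero    f zero = identityˡ (f zero)
  π-tuple (suc n) f i    = proj-⟨⟩ f i

  π-ext : ∀ n {W X} (h k : W ⇒ Sₙ n X) → (∀ i → π n i ∘ h ≈ π n i ∘ k) → h ≈ k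
  π-ext zero    h k p = ≈.trans (≈.sym (identityˡ h)) (≈.trans (p zero) (identityˡ k))
  π-ext (suc n) h k p =
    ≈.trans (⟨⟩-unique (λ i → proj i ∘ k) h p)
            (≈.sym (⟨⟩-unique (λ i → proj i ∘ k) k (λ _ → ≈.refl)))

  tuple-cong : ∀ n {W X} {f g : Fin (suc n) → W ⇒ X} → (∀ i → f i ≈ g i) →
               tuple n f ≈ tuple n g
  tuple-cong n {f = f} {g} p = π-ext n (tuple n f) (tuple n g) λ i →
    ≈.trans (π-tuple n f i) (≈.trans (p i) (≈.sym (π-tuple n g i)))

  π-· : ∀ n {W X} a (h : W ⇒ Sₙ n X) i → π n i ∘ (a · h) ≈ a · (π n i ∘ h)
  π-· zero    a h i = ≈.trans (identityˡ (a · h)) (Mod.*ₗ-cong R.refl (≈.sym (identityˡ h)))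
  π-· (suc n) a h i = Add.*ₗ-homo (proj-additive i _) a h

  ·-∘ : ∀ {W X Y} a (h : X ⇒ Y) (k : W ⇒ X) → (a · h) ∘ k ≈ a · (h ∘ k)
  ·-∘ a h k = Add.*ₗ-homo (precomposition-additive k) a h

  ⟨,⟩-cong : ∀ {W X} {f f′ g g′ : W ⇒ X} → f ≈ f′ → g ≈ g′ → ⟨ f , g ⟩ ≈ ⟨ f′ , g′ ⟩
  ⟨,⟩-cong p q = tuple-cong 1 λ { zero → p ; (suc zero) → q }

  ⟨,⟩-∘ : ∀ {V W X} (f g : W ⇒ X) (k : V ⇒ W) → ⟨ f , g ⟩ ∘ k ≈ ⟨ f ∘ k , g ∘ k ⟩
  ⟨,⟩-∘ f g k = ⟨⟩-unique _ _ λ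
    { zero       → ≈.trans (≈.sym (assoc _ _ _)) (proj-⟨⟩ _ zero ⟨∘ k)
    ; (suc zero) → ≈.trans (≈.sym (assoc _ _ _)) (proj-⟨⟩ _ (suc zero) ⟨∘ k) }

  ⟨π₀,π₁⟩-η : ∀ {W X} (h : W ⇒ S X) → h ≈ ⟨ π₀ ∘ h , π₁ ∘ h ⟩
  ⟨π₀,π₁⟩-η h = ⟨⟩-unique _ h λ { zero → ≈.refl ; (suc zero) → ≈.refl }

  D-cong : ∀ {X Y} {f g : X ⇒ Y} → f ≈ g → D f ≈ D g
  D-cong = Add.⟦⟧-cong D-additive

  D-π : ∀ n {X} i → D (π n {X} i) ≈ π n i ∘ π₁
  D-π zero    i = ≈.trans D-id (≈.sym (identityˡ π₁))
  D-π (suc n) i = D-proj i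

  π-D : ∀ n {W X} (h : W ⇒ Sₙ n X) i → π n i ∘ D h ≈ D (π n i ∘ h)
  π-D n h i = ≈.sym (begin
    D (π n i ∘ h)                    ≈⟨ D-∘ (π n i) h ⟩
    D (π n i) ∘ ⟨ h ∘ π₀ , D h ⟩     ≈⟨ D-π n i ⟨∘ _ ⟩
    (π n i ∘ π₁) ∘ ⟨ h ∘ π₀ , D h ⟩  ≈⟨ assoc _ _ _ ⟩
    π n i ∘ π₁ ∘ ⟨ h ∘ π₀ , D h ⟩    ≈⟨ π n i ∘⟩ proj-⟨⟩ _ (suc zero) ⟩
    π n i ∘ D h                      ∎)

  π-s : ∀ {m n X} .(m≤n : m ≤ n) i →
        π m i ∘ s {m} {n} {X} m≤n ≈ π n (inject≤ i (s≤s m≤n))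
  π-s {m} m≤n i = π-tuple m _ i

  D-s : ∀ {m n X} .(m≤n : m ≤ n) → D (s {m} {n} {X} m≤n) ≈ s {m} {n} {X} m≤n ∘ π₁
  D-s {m} {n} {X} m≤n = π-ext m _ _ λ i → begin
    π m i ∘ D (s m≤n)                     ≈⟨ π-D m (s m≤n) i ⟩
    D (π m i ∘ s {m} {n} {X} m≤n)         ≈⟨ D-cong (π-s m≤n i) ⟩
    D (π n {X} (inject≤ i (s≤s m≤n)))     ≈⟨ D-π n _ ⟩
    π n (inject≤ i (s≤s m≤n)) ∘ π₁        ≈⟨ π-s {m} {n} m≤n i ⟨∘ π₁ ⟨
    (π m i ∘ s {m} {n} {X} m≤n) ∘ π₁      ≈⟨ assoc _ _ _ ⟩
    π m i ∘ s {m} {n} {X} m≤n ∘ π₁        ∎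

  t-cong : ∀ n {X Y} {f g : X ⇒ Y} → f ≈ g → t n f ≈ t n g
  t-cong zero    p = p
  t-cong (suc n) p = D-cong (t-cong n p) ⟨∘ ν n

  Tₙ₁-cong : ∀ n {X Y} {f g : X ⇒ Y} → f ≈ g → Tₙ₁ n f ≈ Tₙ₁ n g
  Tₙ₁-cong n p = tuple-cong n λ i → t-cong (toℕ i) p ⟨∘ s {n = n} (Fin.toℕ≤pred[n] i)

  π₀-ν : ∀ n {X} i → π n i ∘ π₀ ∘ ν n {X} ≈ π (suc n) (inject₁ i)
  π₀-ν n i = ≈.trans (π n i ∘⟩ proj-⟨⟩ _ zero) (π-tuple n _ i)

  π₁-ν : ∀ n {X} i →
         π n i ∘ π₁ ∘ ν n {X} ≈ (suc (toℕ i) ÷ suc n) · π (suc n) (suc i)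
  π₁-ν n i = ≈.trans (π n i ∘⟩ proj-⟨⟩ _ (suc zero)) (π-tuple n _ i)

  ÷-self : ∀ n .{{_ : NonZero n}} → n ÷ n R.≈ R.1#
  ÷-self n = R.trans (R.*-comm _ _) (1/-inverseˡ n)

  ÷-* : ∀ a b c .{{_ : NonZero b}} .{{_ : NonZero c}} → (b ÷ c) R.* (a ÷ b) R.≈ a ÷ c
  ÷-* a b c = R.trans (R.*-comm _ _) (R.trans (R.*-assoc _ _ _) (R.*-congˡ (
    R.trans (R.sym (R.*-assoc _ _ _))
      (R.trans (R.*-congʳ (1/-inverseˡ b)) (R.*-identityˡ _)))))

  t-id : ∀ n {X} → t n (id {X}) ≈ π n (fromℕ n)
  t-id zero    = ≈.refl
  t-id (suc n) {X} = begin
    D (t n id) ∘ ν n                                      ≈⟨ D-cong (t-id n) ⟨∘ ν n ⟩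
    D (π n {X} (fromℕ n)) ∘ ν n                           ≈⟨ D-π n _ ⟨∘ ν n ⟩
    (π n (fromℕ n) ∘ π₁) ∘ ν n                            ≈⟨ assoc _ _ _ ⟩
    π n (fromℕ n) ∘ π₁ ∘ ν n                              ≈⟨ π₁-ν n (fromℕ n) ⟩
    (suc (toℕ (fromℕ n)) ÷ suc n) · π (suc n) (suc (fromℕ n))
      ≡⟨ ≡.cong (λ k → (suc k ÷ suc n) · π (suc n) (suc (fromℕ n))) (Fin.toℕ-fromℕ n) ⟩
    (suc n ÷ suc n) · π (suc n) (suc (fromℕ n))           ≈⟨ Mod.*ₗ-cong (÷-self (suc n)) ≈.refl ⟩
    R.1# · π (suc n) (suc (fromℕ n))                      ≈⟨ Mod.*ₗ-identityˡ _ ⟩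
    π (suc n) (fromℕ (suc n))                             ∎

  Tₙ₁-id : ∀ n {X} → Tₙ₁ n (id {X}) ≈ id
  Tₙ₁-id n {X} = π-ext n _ _ λ i → begin
    π n i ∘ Tₙ₁ n id                                      ≈⟨ π-tuple n _ i ⟩
    t (toℕ i) id ∘ s {n = n} {X} (Fin.toℕ≤pred[n] i)      ≈⟨ t-id (toℕ i) ⟨∘ _ ⟩
    π (toℕ i) (fromℕ (toℕ i)) ∘ s {n = n} {X} (Fin.toℕ≤pred[n] i)
                                                          ≈⟨ π-s {n = n} (Fin.toℕ≤pred[n] i) _ ⟩
    π n (inject≤ (fromℕ (toℕ i)) (s≤s (Fin.toℕ≤pred[n] i)))
      ≡⟨ ≡.cong (π n) (Fin.toℕ-injective
           (≡.trans (Fin.toℕ-inject≤ (fromℕ (toℕ i)) (s≤s (Fin.toℕ≤pred[n] i))) (Fin.toℕ-fromℕ (toℕ i)))) ⟩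
    π n i                                                 ≈⟨ identityʳ _ ⟨
    π n i ∘ id                                            ∎

  s-∘ : ∀ {k m n X} .(k≤m : k ≤ m) .(m≤n : m ≤ n) .(k≤n : k ≤ n) →
        s {k} {m} {X} k≤m ∘ s {m} {n} {X} m≤n ≈ s {k} {n} {X} k≤n
  s-∘ {k} {m} {n} {X} k≤m m≤n k≤n = π-ext k _ _ λ i → begin
    π k i ∘ s {k} {m} {X} k≤m ∘ s {m} {n} {X} m≤n      ≈⟨ assoc _ _ _ ⟨
    (π k i ∘ s {k} {m} {X} k≤m) ∘ s {m} {n} {X} m≤n    ≈⟨ π-s {k} {m} k≤m i ⟨∘ _ ⟩
    π m (inject≤ i (s≤s k≤m)) ∘ s {m} {n} {X} m≤n      ≈⟨ π-s {m} {n} m≤n _ ⟩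
    π n (inject≤ (inject≤ i (s≤s k≤m)) (s≤s m≤n))
      ≡⟨ ≡.cong (π n) (Fin.inject≤-idempotent i (s≤s k≤m) (s≤s m≤n) (s≤s k≤n)) ⟩
    π n (inject≤ i (s≤s k≤n))                          ≈⟨ π-s {k} {n} k≤n i ⟨
    π k i ∘ s {k} {n} {X} k≤n                          ∎

  t∘s-≡ : ∀ {a b n X Y} (f : X ⇒ Y) → a ≡ b → .(a≤n : a ≤ n) .(b≤n : b ≤ n) →
          t a f ∘ s {a} {n} {X} a≤n ≈ t b f ∘ s {b} {n} {X} b≤n
  t∘s-≡ f ≡.refl _ _ = ≈.refl

  s-Tₙ₁ : ∀ {m n X Y} .(m≤n : m ≤ n) (f : X ⇒ Y) →
          s {m} {n} {Y} m≤n ∘ Tₙ₁ n f ≈ Tₙ₁ m f ∘ s {m} {n} {X} m≤n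
  s-Tₙ₁ {m} {n} {X} {Y} m≤n f = π-ext m _ _ λ i →
    let i≤m = Fin.toℕ≤pred[n] i
        i′  = inject≤ i (s≤s m≤n)
    in begin
    π m i ∘ s {m} {n} {Y} m≤n ∘ Tₙ₁ n f                   ≈⟨ assoc _ _ _ ⟨
    (π m i ∘ s {m} {n} {Y} m≤n) ∘ Tₙ₁ n f                 ≈⟨ π-s {m} {n} m≤n i ⟨∘ _ ⟩
    π n i′ ∘ Tₙ₁ n f                                      ≈⟨ π-tuple n _ i′ ⟩
    t (toℕ i′) f ∘ s {n = n} {X} (Fin.toℕ≤pred[n] i′)
      ≈⟨ t∘s-≡ {n = n} f (Fin.toℕ-inject≤ i (s≤s m≤n))
           (Fin.toℕ≤pred[n] i′) (ℕ.≤-trans i≤m m≤n) ⟩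
    t (toℕ i) f ∘ s {n = n} {X} (ℕ.≤-trans i≤m m≤n)
      ≈⟨ t (toℕ i) f ∘⟩ s-∘ {toℕ i} {m} {n} {X} i≤m m≤n (ℕ.≤-trans i≤m m≤n) ⟨
    t (toℕ i) f ∘ s {n = m} {X} i≤m ∘ s {m} {n} {X} m≤n   ≈⟨ assoc _ _ _ ⟨
    (t (toℕ i) f ∘ s {n = m} {X} i≤m) ∘ s {m} {n} {X} m≤n ≈⟨ π-tuple m _ i ⟨∘ _ ⟨
    (π m i ∘ Tₙ₁ m f) ∘ s {m} {n} {X} m≤n                 ≈⟨ assoc _ _ _ ⟩
    π m i ∘ Tₙ₁ m f ∘ s {m} {n} {X} m≤n                   ∎

  s-π₀-ν : ∀ {k n X} .(k≤n : k ≤ n) →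
           s {k} {n} {X} k≤n ∘ π₀ ∘ ν n ≈ π₀ ∘ ν k ∘ s {suc k} {suc n} {X} (s≤s k≤n)
  s-π₀-ν {k} {n} {X} k≤n = π-ext k _ _ λ i → begin
    π k i ∘ s {k} {n} {X} k≤n ∘ π₀ ∘ ν n               ≈⟨ assoc _ _ _ ⟨
    (π k i ∘ s {k} {n} {X} k≤n) ∘ π₀ ∘ ν n             ≈⟨ π-s {k} {n} k≤n i ⟨∘ _ ⟩
    π n (inject≤ i (s≤s k≤n)) ∘ π₀ ∘ ν n               ≈⟨ π₀-ν n _ ⟩
    π (suc n) (inject₁ (inject≤ i (s≤s k≤n)))
      ≡⟨ ≡.cong (π (suc n)) (Fin.toℕ-injective (≡.trans (Fin.toℕ-inject₁ (inject≤ i (s≤s k≤n)))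
           (≡.trans (Fin.toℕ-inject≤ i (s≤s k≤n)) (≡.sym
             (≡.trans (Fin.toℕ-inject≤ (inject₁ i) (s≤s (s≤s k≤n))) (Fin.toℕ-inject₁ i)))))) ⟩
    π (suc n) (inject≤ (inject₁ i) (s≤s (s≤s k≤n)))    ≈⟨ π-s {suc k} {suc n} (s≤s k≤n) (inject₁ i) ⟨
    π (suc k) (inject₁ i) ∘ σ                          ≈⟨ π₀-ν k i ⟨∘ σ ⟨
    (π k i ∘ π₀ ∘ ν k) ∘ σ                             ≈⟨ assoc _ _ _ ⟩
    π k i ∘ (π₀ ∘ ν k) ∘ σ                             ≈⟨ π k i ∘⟩ assoc _ _ _ ⟩
    π k i ∘ π₀ ∘ ν k ∘ σ                               ∎
    where σ = s {suc k} {suc n} {X} (s≤s k≤n)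

  s-π₁-ν : ∀ {k n X} .(k≤n : k ≤ n) →
           s {k} {n} {X} k≤n ∘ π₁ ∘ ν n
             ≈ (suc k ÷ suc n) · (π₁ ∘ ν k ∘ s {suc k} {suc n} {X} (s≤s k≤n))
  s-π₁-ν {k} {n} {X} k≤n = π-ext k _ _ λ i → begin
    π k i ∘ s {k} {n} {X} k≤n ∘ π₁ ∘ ν n               ≈⟨ assoc _ _ _ ⟨
    (π k i ∘ s {k} {n} {X} k≤n) ∘ π₁ ∘ ν n             ≈⟨ π-s {k} {n} k≤n i ⟨∘ _ ⟩
    π n (inject≤ i (s≤s k≤n)) ∘ π₁ ∘ ν n               ≈⟨ π₁-ν n _ ⟩
    (suc (toℕ (inject≤ i (s≤s k≤n))) ÷ suc n) · π (suc n) (suc (inject≤ i (s≤s k≤n)))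
      ≡⟨ ≡.cong (λ m → (suc m ÷ suc n) · π (suc n) (suc (inject≤ i (s≤s k≤n))))
                (Fin.toℕ-inject≤ i (s≤s k≤n)) ⟩
    (suc (toℕ i) ÷ suc n) · π (suc n) (suc (inject≤ i (s≤s k≤n)))
      ≈⟨ Mod.*ₗ-cong (R.sym (÷-* (suc (toℕ i)) (suc k) (suc n)))
           (≈.sym (π-s {suc k} {suc n} (s≤s k≤n) (suc i))) ⟩
    (c R.* (suc (toℕ i) ÷ suc k)) · (π (suc k) (suc i) ∘ σ)   ≈⟨ Mod.*ₗ-assoc _ _ _ ⟩
    c · (suc (toℕ i) ÷ suc k) · (π (suc k) (suc i) ∘ σ)       ≈⟨ Mod.*ₗ-cong R.refl (·-∘ _ _ σ) ⟨
    c · (((suc (toℕ i) ÷ suc k) · π (suc k) (suc i)) ∘ σ)     ≈⟨ Mod.*ₗ-cong R.refl (π₁-ν k i ⟨∘ σ) ⟨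
    c · ((π k i ∘ π₁ ∘ ν k) ∘ σ)                              ≈⟨ Mod.*ₗ-cong R.refl (assoc _ _ _) ⟩
    c · (π k i ∘ (π₁ ∘ ν k) ∘ σ)                              ≈⟨ Mod.*ₗ-cong R.refl (π k i ∘⟩ assoc _ _ _) ⟩
    c · (π k i ∘ π₁ ∘ ν k ∘ σ)                                ≈⟨ π-· k c _ i ⟨
    π k i ∘ (c · (π₁ ∘ ν k ∘ σ))                              ∎
    where
    σ = s {suc k} {suc n} {X} (s≤s k≤n)
    c = suc k ÷ suc n

  D-t∘s : ∀ {k n X Y} .(k≤n : k ≤ n) (f : X ⇒ Y) →
          D (t k f ∘ s {k} {n} {X} k≤n) ∘ ν n
            ≈ (suc k ÷ suc n) · (t (suc k) f ∘ s {suc k} {suc n} {X} (s≤s k≤n))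
  D-t∘s {k} {n} {X} k≤n f = begin
    D (t k f ∘ σ′) ∘ ν n                                  ≈⟨ D-∘ (t k f) σ′ ⟨∘ ν n ⟩
    (D (t k f) ∘ ⟨ σ′ ∘ π₀ , D σ′ ⟩) ∘ ν n                ≈⟨ assoc _ _ _ ⟩
    D (t k f) ∘ ⟨ σ′ ∘ π₀ , D σ′ ⟩ ∘ ν n                  ≈⟨ D (t k f) ∘⟩ ⟨,⟩-∘ _ _ (ν n) ⟩
    D (t k f) ∘ ⟨ (σ′ ∘ π₀) ∘ ν n , D σ′ ∘ ν n ⟩
      ≈⟨ D (t k f) ∘⟩ ⟨,⟩-cong
           (≈.trans (assoc _ _ _) (s-π₀-ν {k} {n} k≤n))
           (≈.trans (D-s {k} {n} k≤n ⟨∘ ν n) (≈.trans (assoc _ _ _) (s-π₁-ν {k} {n} k≤n))) ⟩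
    D (t k f) ∘ ⟨ π₀ ∘ ν k ∘ σ , c · (π₁ ∘ ν k ∘ σ) ⟩     ≈⟨ Add.*ₗ-homo (D-additive₂ (t k f) _) c _ ⟩
    c · (D (t k f) ∘ ⟨ π₀ ∘ ν k ∘ σ , π₁ ∘ ν k ∘ σ ⟩)     ≈⟨ Mod.*ₗ-cong R.refl (D (t k f) ∘⟩ ⟨π₀,π₁⟩-η _) ⟨
    c · (D (t k f) ∘ ν k ∘ σ)                             ≈⟨ Mod.*ₗ-cong R.refl (assoc _ _ _) ⟨
    c · (t (suc k) f ∘ σ)                                 ∎
    where
    σ′ = s {k} {n} {X} k≤n
    σ  = s {suc k} {suc n} {X} (s≤s k≤n)
    c  = suc k ÷ suc n

  ν-Tₙ₁ : ∀ n {X Y} (f : X ⇒ Y) →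
          ⟨ Tₙ₁ n f ∘ π₀ , D (Tₙ₁ n f) ⟩ ∘ ν n ≈ ν n ∘ Tₙ₁ (suc n) f
  ν-Tₙ₁ n {X} f = begin
    ⟨ T ∘ π₀ , D T ⟩ ∘ ν n                    ≈⟨ ⟨,⟩-∘ _ _ (ν n) ⟩
    ⟨ (T ∘ π₀) ∘ ν n , D T ∘ ν n ⟩            ≈⟨ ⟨,⟩-cong (π-ext n _ _ base) (π-ext n _ _ fibre) ⟩
    ⟨ π₀ ∘ ν n ∘ T⁺ , π₁ ∘ ν n ∘ T⁺ ⟩         ≈⟨ ⟨π₀,π₁⟩-η _ ⟨
    ν n ∘ T⁺                                  ∎
    where
    T  = Tₙ₁ n f
    T⁺ = Tₙ₁ (suc n) f

    π₀-ν-s : ∀ {k} .(k≤n : k ≤ n) .(k≤1+n : k ≤ suc n) →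
             s {k} {n} {X} k≤n ∘ π₀ ∘ ν n ≈ s {k} {suc n} {X} k≤1+n
    π₀-ν-s {k} k≤n k≤1+n = π-ext k _ _ λ i → begin
      π k i ∘ s {k} {n} {X} k≤n ∘ π₀ ∘ ν n        ≈⟨ assoc _ _ _ ⟨
      (π k i ∘ s {k} {n} {X} k≤n) ∘ π₀ ∘ ν n      ≈⟨ π-s {k} {n} k≤n i ⟨∘ _ ⟩
      π n (inject≤ i (s≤s k≤n)) ∘ π₀ ∘ ν n        ≈⟨ π₀-ν n _ ⟩
      π (suc n) (inject₁ (inject≤ i (s≤s k≤n)))
        ≡⟨ ≡.cong (π (suc n)) (Fin.toℕ-injective (≡.trans (Fin.toℕ-inject₁ (inject≤ i (s≤s k≤n)))
             (≡.trans (Fin.toℕ-inject≤ i (s≤s k≤n)) (≡.sym (Fin.toℕ-inject≤ i (s≤s k≤1+n)))))) ⟩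
      π (suc n) (inject≤ i (s≤s k≤1+n))           ≈⟨ π-s {k} {suc n} k≤1+n i ⟨
      π k i ∘ s {k} {suc n} {X} k≤1+n             ∎

    base : ∀ i → π n i ∘ (T ∘ π₀) ∘ ν n ≈ π n i ∘ π₀ ∘ ν n ∘ T⁺
    base i = begin
      π n i ∘ (T ∘ π₀) ∘ ν n                      ≈⟨ π n i ∘⟩ assoc _ _ _ ⟩
      π n i ∘ T ∘ π₀ ∘ ν n                        ≈⟨ assoc _ _ _ ⟨
      (π n i ∘ T) ∘ π₀ ∘ ν n                      ≈⟨ π-tuple n _ i ⟨∘ _ ⟩
      (t (toℕ i) f ∘ s {n = n} {X} i≤n) ∘ π₀ ∘ ν n  ≈⟨ assoc _ _ _ ⟩
      t (toℕ i) f ∘ s {n = n} {X} i≤n ∘ π₀ ∘ ν n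
        ≈⟨ t (toℕ i) f ∘⟩ π₀-ν-s i≤n (ℕ.m≤n⇒m≤1+n i≤n) ⟩
      t (toℕ i) f ∘ s {n = suc n} {X} (ℕ.m≤n⇒m≤1+n i≤n)
        ≈⟨ t∘s-≡ {n = suc n} f (≡.sym (Fin.toℕ-inject₁ i))
             (ℕ.m≤n⇒m≤1+n i≤n) (Fin.toℕ≤pred[n] (inject₁ i)) ⟩
      t (toℕ (inject₁ i)) f ∘ s {n = suc n} {X} (Fin.toℕ≤pred[n] (inject₁ i))
                                                  ≈⟨ π-tuple (suc n) _ (inject₁ i) ⟨
      π (suc n) (inject₁ i) ∘ T⁺                  ≈⟨ π₀-ν n i ⟨∘ T⁺ ⟨
      (π n i ∘ π₀ ∘ ν n) ∘ T⁺                     ≈⟨ assoc _ _ _ ⟩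
      π n i ∘ (π₀ ∘ ν n) ∘ T⁺                     ≈⟨ π n i ∘⟩ assoc _ _ _ ⟩
      π n i ∘ π₀ ∘ ν n ∘ T⁺                       ∎
      where i≤n = Fin.toℕ≤pred[n] i

    fibre : ∀ i → π n i ∘ D T ∘ ν n ≈ π n i ∘ π₁ ∘ ν n ∘ T⁺
    fibre i = begin
      π n i ∘ D T ∘ ν n                           ≈⟨ assoc _ _ _ ⟨
      (π n i ∘ D T) ∘ ν n                         ≈⟨ π-D n T i ⟨∘ ν n ⟩
      D (π n i ∘ T) ∘ ν n                         ≈⟨ D-cong (π-tuple n _ i) ⟨∘ ν n ⟩
      D (t (toℕ i) f ∘ s {n = n} {X} (Fin.toℕ≤pred[n] i)) ∘ ν n
                                                  ≈⟨ D-t∘s {toℕ i} {n} (Fin.toℕ≤pred[n] i) f ⟩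
      c · (t (suc (toℕ i)) f ∘ s {n = suc n} {X} (s≤s (Fin.toℕ≤pred[n] i)))
                                                  ≈⟨ Mod.*ₗ-cong R.refl (π-tuple (suc n) _ (suc i)) ⟨
      c · (π (suc n) (suc i) ∘ T⁺)                ≈⟨ ·-∘ c _ T⁺ ⟨
      (c · π (suc n) (suc i)) ∘ T⁺                ≈⟨ π₁-ν n i ⟨∘ T⁺ ⟨
      (π n i ∘ π₁ ∘ ν n) ∘ T⁺                     ≈⟨ assoc _ _ _ ⟩
      π n i ∘ (π₁ ∘ ν n) ∘ T⁺                     ≈⟨ π n i ∘⟩ assoc _ _ _ ⟩
      π n i ∘ π₁ ∘ ν n ∘ T⁺                       ∎
      where c = suc (toℕ i) ÷ suc n

  t-∘ : ∀ n {X Y Z} (g : Y ⇒ Z) (f : X ⇒ Y) → t n (g ∘ f) ≈ t n g ∘ Tₙ₁ n f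
  t-∘ zero    g f = g ∘⟩ ≈.sym (identityʳ f)
  t-∘ (suc n) g f = begin
    D (t n (g ∘ f)) ∘ ν n                               ≈⟨ D-cong (t-∘ n g f) ⟨∘ ν n ⟩
    D (t n g ∘ Tₙ₁ n f) ∘ ν n                           ≈⟨ D-∘ (t n g) (Tₙ₁ n f) ⟨∘ ν n ⟩
    (D (t n g) ∘ ⟨ Tₙ₁ n f ∘ π₀ , D (Tₙ₁ n f) ⟩) ∘ ν n  ≈⟨ assoc _ _ _ ⟩
    D (t n g) ∘ ⟨ Tₙ₁ n f ∘ π₀ , D (Tₙ₁ n f) ⟩ ∘ ν n    ≈⟨ D (t n g) ∘⟩ ν-Tₙ₁ n f ⟩
    D (t n g) ∘ ν n ∘ Tₙ₁ (suc n) f                     ≈⟨ assoc _ _ _ ⟨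
    t (suc n) g ∘ Tₙ₁ (suc n) f                         ∎

  Tₙ₁-∘ : ∀ n {X Y Z} (g : Y ⇒ Z) (f : X ⇒ Y) → Tₙ₁ n (g ∘ f) ≈ Tₙ₁ n g ∘ Tₙ₁ n f
  Tₙ₁-∘ n {X} {Y} g f = π-ext n _ _ λ i →
    let i≤n = Fin.toℕ≤pred[n] i in begin
    π n i ∘ Tₙ₁ n (g ∘ f)                                     ≈⟨ π-tuple n _ i ⟩
    t (toℕ i) (g ∘ f) ∘ s {n = n} {X} i≤n                     ≈⟨ t-∘ (toℕ i) g f ⟨∘ _ ⟩
    (t (toℕ i) g ∘ Tₙ₁ (toℕ i) f) ∘ s {n = n} {X} i≤n         ≈⟨ assoc _ _ _ ⟩
    t (toℕ i) g ∘ Tₙ₁ (toℕ i) f ∘ s {n = n} {X} i≤n           ≈⟨ t (toℕ i) g ∘⟩ s-Tₙ₁ {n = n} i≤n f ⟨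
    t (toℕ i) g ∘ s {n = n} {Y} i≤n ∘ Tₙ₁ n f                 ≈⟨ assoc _ _ _ ⟨
    (t (toℕ i) g ∘ s {n = n} {Y} i≤n) ∘ Tₙ₁ n f               ≈⟨ π-tuple n _ i ⟨∘ _ ⟨
    (π n i ∘ Tₙ₁ n g) ∘ Tₙ₁ n f                               ≈⟨ assoc _ _ _ ⟩
    π n i ∘ Tₙ₁ n g ∘ Tₙ₁ n f                                 ∎

  T : ℕ → Functor category category
  T n = record
    { F₀           = Sₙ n
    ; F₁           = Tₙ₁ n
    ; F-cong       = Tₙ₁-cong n
    ; identity     = Tₙ₁-id n
    ; homomorphism = Tₙ₁-∘ n
    }

{-# OPTIONS --safe #-}
module Submission where

-- t n f computes the n-th Taylor coefficient of f along the formal curve Σ xₖ εᵏ, and l n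
-- multiplies the argument of ε by a second parameter, so the claim is that t i f is homogeneous of
-- degree i in this formal parameter.  An Euler-operator argument would only give i · h ≈ j · h,
-- which says nothing in a semimodule without cancellation.  Instead one differentiates in the formal
-- parameter: the tangent of the curve (xₖ εᵏ)ₖ has no component in degree 0, and for such tangents
-- D (t (1 + i) f) reduces to t i (D f) (lemma τ-shift).  Hence t (1 + j) (t (1 + i) f) on the
-- diagonal reduces to t j (t i (D f)) on the diagonal of the curve (xₖ, (k + 1)/(j + 1) xₖ₊₁), and
-- induction on i and j applies.

open import Algebra.Bundles using (CommutativeSemiring)
open import Algebra.Module.Structures using (IsLeftSemimodule)
open import Algebra.Module.Morphism.Structures using (module LeftSemimoduleMorphisms)
open import Data.Bool.Base using (true; false; if_then_else_)
open import Data.Fin.Base using (Fin; zero; suc; toℕ; fromℕ; inject₁; inject≤)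
import Data.Fin.Properties as Fin
open import Data.Nat.Base using (ℕ; zero; suc; _≡ᵇ_; _≥_; _≤_; s≤s)
import Data.Nat.Properties as ℕ
open import Data.Nat.Properties using (_≟_)
open import Data.Product.Base as Product using (_×_)
open import Data.Unit.Base using (tt)
open import Level using (Level)
open import Relation.Binary.PropositionalEquality as ≡ using (_≡_)
open import Relation.Binary.Structures using (IsEquivalence)
import Relation.Binary.Reasoning.Setoid as SetoidReasoning
open import Relation.Nullary.Decidable using (does)
open import Defs

module Jets
  {r ℓr o ℓ e : Level} {R : CommutativeSemiring r ℓr} (inverses : IntegerInverses R)
  (𝒞 : CartesianDifferentialCategory R o ℓ e) where

  open HigherTangent inverses 𝒞
  private
    module ≈ {X} {Y} = IsEquivalence (equiv {X} {Y})
    module R = CommutativeSemiring R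
    module Mod {X} {Y} = IsLeftSemimodule (isLeftSemimodule {X} {Y})
    module Add {X Y Z W} {M : X ⇒ Y → Z ⇒ W}
               (h : IsAdditive {R = R} (Hom X Y) (Hom Z W) M) =
      LeftSemimoduleMorphisms.IsLeftSemimoduleHomomorphism h
    module ≈-Reasoning {X} {Y} = SetoidReasoning (homSetoid X Y)
    open ≈-Reasoning

    infixl 9 _⟨∘_
    infixr 9 _∘⟩_

    _⟨∘_ : ∀ {X Y Z} {g g′ : Y ⇒ Z} → g ≈ g′ → (f : X ⇒ Y) → g ∘ f ≈ g′ ∘ f
    p ⟨∘ f = ∘-cong p ≈.refl

    _∘⟩_ : ∀ {X Y Z} (g : Y ⇒ Z) {f f′ : X ⇒ Y} → f ≈ f′ → g ∘ f ≈ g ∘ f′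
    g ∘⟩ p = ∘-cong ≈.refl p

    ·-congˡ : ∀ {X Y} a {f g : X ⇒ Y} → f ≈ g → a · f ≈ a · g
    ·-congˡ a = Mod.*ₗ-cong R.refl

    ·-congʳ : ∀ {X Y} {a b} (f : X ⇒ Y) → a R.≈ b → a · f ≈ b · f
    ·-congʳ f p = Mod.*ₗ-cong p ≈.refl

  -- Semimodule structure of tuples and pairs

  𝟘-∘ : ∀ {W X Y} (k : W ⇒ X) → 𝟘 {X} {Y} ∘ k ≈ 𝟘
  𝟘-∘ k = Add.0ᴹ-homo (precomposition-additive k)

  π-𝟘 : ∀ n {W X} i → π n {X} i ∘ 𝟘 {W} ≈ 𝟘
  π-𝟘 zero    i = identityˡ 𝟘
  π-𝟘 (suc n) i = Add.0ᴹ-homo (proj-additive i _)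

  π-+ : ∀ n {W X} (h k : W ⇒ Sₙ n X) i → π n i ∘ (h + k) ≈ π n i ∘ h + π n i ∘ k
  π-+ zero    h k i = ≈.trans (identityˡ _) (Mod.+ᴹ-cong (≈.sym (identityˡ h)) (≈.sym (identityˡ k)))
  π-+ (suc n) h k i = Add.+ᴹ-homo (proj-additive i _) h k

  tuple-∘ : ∀ n {V W X} (f : Fin (suc n) → W ⇒ X) (k : V ⇒ W) →
            tuple n f ∘ k ≈ tuple n (λ i → f i ∘ k)
  tuple-∘ n f k = π-ext n _ _ λ i → begin
    π n i ∘ tuple n f ∘ k            ≈⟨ assoc _ _ _ ⟨
    (π n i ∘ tuple n f) ∘ k          ≈⟨ π-tuple n f i ⟨∘ k ⟩
    f i ∘ k                          ≈⟨ π-tuple n _ i ⟨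
    π n i ∘ tuple n (λ i → f i ∘ k)  ∎

  tuple-𝟘 : ∀ n {W X} → tuple n (λ _ → 𝟘 {W} {X}) ≈ 𝟘
  tuple-𝟘 n = π-ext n _ _ λ i → ≈.trans (π-tuple n _ i) (≈.sym (π-𝟘 n i))

  tuple-+ : ∀ n {W X} (f g : Fin (suc n) → W ⇒ X) →
            tuple n (λ i → f i + g i) ≈ tuple n f + tuple n g
  tuple-+ n f g = π-ext n _ _ λ i → begin
    π n i ∘ tuple n (λ i → f i + g i)          ≈⟨ π-tuple n _ i ⟩
    f i + g i                                  ≈⟨ Mod.+ᴹ-cong (π-tuple n f i) (π-tuple n g i) ⟨
    π n i ∘ tuple n f + π n i ∘ tuple n g      ≈⟨ π-+ n _ _ i ⟨
    π n i ∘ (tuple n f + tuple n g)            ∎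

  tuple-· : ∀ n {W X} a (f : Fin (suc n) → W ⇒ X) → tuple n (λ i → a · f i) ≈ a · tuple n f
  tuple-· n a f = π-ext n _ _ λ i → begin
    π n i ∘ tuple n (λ i → a · f i)  ≈⟨ π-tuple n _ i ⟩
    a · f i                          ≈⟨ ·-congˡ a (π-tuple n f i) ⟨
    a · (π n i ∘ tuple n f)          ≈⟨ π-· n a _ i ⟨
    π n i ∘ (a · tuple n f)          ∎

  ⟨,⟩-𝟘 : ∀ {W X} → ⟨ 𝟘 {W} {X} , 𝟘 ⟩ ≈ 𝟘
  ⟨,⟩-𝟘 = ≈.trans (tuple-cong 1 λ { zero → ≈.refl ; (suc zero) → ≈.refl }) (tuple-𝟘 1)

  ⟨,⟩-+ : ∀ {W X} (f g f′ g′ : W ⇒ X) → ⟨ f + f′ , g + g′ ⟩ ≈ ⟨ f , g ⟩ + ⟨ f′ , g′ ⟩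
  ⟨,⟩-+ f g f′ g′ =
    ≈.trans (tuple-cong 1 λ { zero → ≈.refl ; (suc zero) → ≈.refl }) (tuple-+ 1 _ _)

  ⟨,⟩-· : ∀ {W X} a (f g : W ⇒ X) → ⟨ a · f , a · g ⟩ ≈ a · ⟨ f , g ⟩
  ⟨,⟩-· a f g =
    ≈.trans (tuple-cong 1 λ { zero → ≈.refl ; (suc zero) → ≈.refl }) (tuple-· 1 a _)

  π₀-⟨,⟩ : ∀ {W X} (f g : W ⇒ X) → π₀ ∘ ⟨ f , g ⟩ ≈ f
  π₀-⟨,⟩ f g = proj-⟨⟩ _ zero

  π₁-⟨,⟩ : ∀ {W X} (f g : W ⇒ X) → π₁ ∘ ⟨ f , g ⟩ ≈ g
  π₁-⟨,⟩ f g = proj-⟨⟩ _ (suc zero)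

  -- Linear morphisms and their higher derivatives

  -- Linearity in the sense of differential categories; by `D-additive₂` it implies additivity.
  -- Substituting a linear map produces no correction terms under `D` or `t n`.
  IsLinear : ∀ {X Y} → X ⇒ Y → Set e
  IsLinear h = D h ≈ h ∘ π₁

  𝟘-linear : ∀ {X Y} → IsLinear (𝟘 {X} {Y})
  𝟘-linear = ≈.trans (Add.0ᴹ-homo D-additive) (≈.sym (𝟘-∘ π₁))

  ·-linear : ∀ {X Y} a {h : X ⇒ Y} → IsLinear h → IsLinear (a · h)
  ·-linear a {h} p =
    ≈.trans (Add.*ₗ-homo D-additive a h) (≈.trans (·-congˡ a p) (≈.sym (·-∘ a h π₁)))

  D-∘-linear : ∀ {W X Y Z} (g : Y ⇒ Z) {h : X ⇒ Y} → IsLinear h → (x u : W ⇒ X) →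
               D (g ∘ h) ∘ ⟨ x , u ⟩ ≈ D g ∘ ⟨ h ∘ x , h ∘ u ⟩
  D-∘-linear g {h} p x u = begin
    D (g ∘ h) ∘ ⟨ x , u ⟩                                ≈⟨ D-∘ g h ⟨∘ _ ⟩
    (D g ∘ ⟨ h ∘ π₀ , D h ⟩) ∘ ⟨ x , u ⟩                 ≈⟨ assoc _ _ _ ⟩
    D g ∘ ⟨ h ∘ π₀ , D h ⟩ ∘ ⟨ x , u ⟩                   ≈⟨ D g ∘⟩ ⟨,⟩-∘ _ _ _ ⟩
    D g ∘ ⟨ (h ∘ π₀) ∘ ⟨ x , u ⟩ , D h ∘ ⟨ x , u ⟩ ⟩
      ≈⟨ D g ∘⟩ ⟨,⟩-cong
           (≈.trans (assoc _ _ _) (h ∘⟩ π₀-⟨,⟩ x u))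
           (≈.trans (p ⟨∘ _) (≈.trans (assoc _ _ _) (h ∘⟩ π₁-⟨,⟩ x u))) ⟩
    D g ∘ ⟨ h ∘ x , h ∘ u ⟩                              ∎

  ∘-linear : ∀ {X Y Z} {g : Y ⇒ Z} {h : X ⇒ Y} → IsLinear g → IsLinear h → IsLinear (g ∘ h)
  ∘-linear {g = g} {h} p q = begin
    D (g ∘ h)                     ≈⟨ D-∘ g h ⟩
    D g ∘ ⟨ h ∘ π₀ , D h ⟩        ≈⟨ p ⟨∘ _ ⟩
    (g ∘ π₁) ∘ ⟨ h ∘ π₀ , D h ⟩   ≈⟨ assoc _ _ _ ⟩
    g ∘ π₁ ∘ ⟨ h ∘ π₀ , D h ⟩     ≈⟨ g ∘⟩ π₁-⟨,⟩ _ _ ⟩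
    g ∘ D h                       ≈⟨ g ∘⟩ q ⟩
    g ∘ h ∘ π₁                    ≈⟨ assoc _ _ _ ⟨
    (g ∘ h) ∘ π₁                  ∎

  tuple-linear : ∀ n {W X} {f : Fin (suc n) → W ⇒ X} → (∀ i → IsLinear (f i)) →
                 IsLinear (tuple n f)
  tuple-linear n {f = f} p = π-ext n _ _ λ i → begin
    π n i ∘ D (tuple n f)      ≈⟨ π-D n _ i ⟩
    D (π n i ∘ tuple n f)      ≈⟨ D-cong (π-tuple n f i) ⟩
    D (f i)                    ≈⟨ p i ⟩
    f i ∘ π₁                   ≈⟨ π-tuple n f i ⟨∘ π₁ ⟨
    (π n i ∘ tuple n f) ∘ π₁   ≈⟨ assoc _ _ _ ⟩
    π n i ∘ tuple n f ∘ π₁     ∎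

  ⟨,⟩-linear : ∀ {W X} {f g : W ⇒ X} → IsLinear f → IsLinear g → IsLinear ⟨ f , g ⟩
  ⟨,⟩-linear p q = tuple-linear 1 λ { zero → p ; (suc zero) → q }

  π₀-linear : ∀ {X} → IsLinear (π₀ {X})
  π₀-linear = D-proj zero

  π₁-linear : ∀ {X} → IsLinear (π₁ {X})
  π₁-linear = D-proj (suc zero)

  ν-linear : ∀ n {X} → IsLinear (ν n {X})
  ν-linear n = ⟨,⟩-linear (tuple-linear n λ i → D-π (suc n) _)
                          (tuple-linear n λ i → ·-linear _ (D-π (suc n) _))

  π-t : ∀ k n {X Y} (h : X ⇒ Sₙ n Y) i → π n i ∘ t k h ≈ t k (π n i ∘ h)
  π-t zero    n h i = ≈.refl
  π-t (suc k) n h i = begin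
    π n i ∘ D (t k h) ∘ ν k      ≈⟨ assoc _ _ _ ⟨
    (π n i ∘ D (t k h)) ∘ ν k    ≈⟨ π-D n (t k h) i ⟨∘ ν k ⟩
    D (π n i ∘ t k h) ∘ ν k      ≈⟨ D-cong (π-t k n h i) ⟨∘ ν k ⟩
    D (t k (π n i ∘ h)) ∘ ν k    ∎

  -- `D h` ignores the base point, so by induction only the last coordinate of the second half of
  -- `ν n` counts, and its weight (n + 1)/(n + 1) is 1.
  t-linear : ∀ n {X Y} {h : X ⇒ Y} → IsLinear h → t n h ≈ h ∘ π n (fromℕ n)
  t-linear zero    {h = h} p = ≈.sym (identityʳ h)
  t-linear (suc n) {h = h} p = begin
    D (t n h) ∘ ν n                           ≈⟨ D-cong (t-linear n p) ⟨∘ ν n ⟩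
    D (h ∘ π n (fromℕ n)) ∘ ν n               ≈⟨ ∘-linear p (D-π n (fromℕ n)) ⟨∘ ν n ⟩
    ((h ∘ π n (fromℕ n)) ∘ π₁) ∘ ν n          ≈⟨ assoc _ _ _ ⟩
    (h ∘ π n (fromℕ n)) ∘ π₁ ∘ ν n            ≈⟨ assoc _ _ _ ⟩
    h ∘ π n (fromℕ n) ∘ π₁ ∘ ν n              ≈⟨ h ∘⟩ π₁-ν n (fromℕ n) ⟩
    h ∘ ((suc (toℕ (fromℕ n)) ÷ suc n) · top)
      ≡⟨ ≡.cong (λ m → h ∘ ((suc m ÷ suc n) · top)) (Fin.toℕ-fromℕ n) ⟩
    h ∘ ((suc n ÷ suc n) · top)
      ≈⟨ h ∘⟩ ≈.trans (·-congʳ _ (÷-self (suc n))) (Mod.*ₗ-identityˡ _) ⟩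
    h ∘ top                                   ∎
    where top = π (suc n) (fromℕ (suc n))

  Tₙ₁-linear : ∀ n {X Y} {h : X ⇒ Y} → IsLinear h → Tₙ₁ n h ≈ Sₙ₁ n h
  Tₙ₁-linear n {X} {h = h} p = tuple-cong n λ i →
    let σ   = s {n = n} {X} (Fin.toℕ≤pred[n] i)
        top = fromℕ (toℕ i)
    in begin
    t (toℕ i) h ∘ σ                 ≈⟨ t-linear (toℕ i) p ⟨∘ σ ⟩
    (h ∘ π (toℕ i) top) ∘ σ         ≈⟨ assoc _ _ _ ⟩
    h ∘ π (toℕ i) top ∘ σ           ≈⟨ h ∘⟩ π-s {n = n} (Fin.toℕ≤pred[n] i) top ⟩
    h ∘ π n (inject≤ top (s≤s (Fin.toℕ≤pred[n] i)))
      ≡⟨ ≡.cong (λ k → h ∘ π n k) (Fin.toℕ-injective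
           (≡.trans (Fin.toℕ-inject≤ top (s≤s (Fin.toℕ≤pred[n] i))) (Fin.toℕ-fromℕ (toℕ i)))) ⟩
    h ∘ π n i                       ∎

  t-∘-linear : ∀ n {X Y Z} (g : Y ⇒ Z) {h : X ⇒ Y} → IsLinear h →
               t n (g ∘ h) ≈ t n g ∘ Sₙ₁ n h
  t-∘-linear n g {h} p = ≈.trans (t-∘ n g h) (t n g ∘⟩ Tₙ₁-linear n p)

  -- Jets and coefficients along them

  -- Jets are ℕ-indexed sequences of generalized elements; t n and tup n only see the entries
  -- 0, …, n.
  Seq : Obj → Obj → Set ℓ
  Seq W X = ℕ → W ⇒ X

  tup : ∀ n {W X} → Seq W X → W ⇒ Sₙ n X
  tup n x = tuple n (λ i → x (toℕ i))

  tup-cong : ∀ n {W X} {x y : Seq W X} → (∀ k → x k ≈ y k) → tup n x ≈ tup n y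
  tup-cong n p = tuple-cong n λ i → p (toℕ i)

  π-tup : ∀ n {W X} (x : Seq W X) i → π n i ∘ tup n x ≈ x (toℕ i)
  π-tup n x i = π-tuple n _ i

  -- Indices past `n` go to `n`, a default that `tup n` never reads; totality makes the projections
  -- of `Sₙ n X` into a `Seq`.
  clamp : ∀ n → ℕ → Fin (suc n)
  clamp zero    k       = zero
  clamp (suc n) zero    = zero
  clamp (suc n) (suc k) = suc (clamp n k)

  clamp-toℕ : ∀ n (i : Fin (suc n)) → clamp n (toℕ i) ≡ i
  clamp-toℕ zero    zero    = ≡.refl
  clamp-toℕ (suc n) zero    = ≡.refl
  clamp-toℕ (suc n) (suc i) = ≡.cong suc (clamp-toℕ n i)

  toℕ-clamp : ∀ {n k} → k ≤ n → toℕ (clamp n k) ≡ k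
  toℕ-clamp {zero}  {zero}  p       = ≡.refl
  toℕ-clamp {suc n} {zero}  p       = ≡.refl
  toℕ-clamp {suc n} {suc k} (s≤s p) = ≡.cong suc (toℕ-clamp p)

  -- The generic jet: an identity of `τ n` at all jets, read here, becomes by `τ-coord` an identity
  -- of morphisms, which may be used under `D`.
  coord : ∀ n {X} → Seq (Sₙ n X) X
  coord n k = π n (clamp n k)

  coord-linear : ∀ n {X} k → IsLinear (coord n {X} k)
  coord-linear n k = D-π n _

  coord-toℕ : ∀ n {X} i → coord n {X} (toℕ i) ≡ π n i
  coord-toℕ n i = ≡.cong (π n) (clamp-toℕ n i)

  tup-coord : ∀ n {X} → tup n (coord n {X}) ≈ id
  tup-coord n = π-ext n _ _ λ i → begin
    π n i ∘ tup n (coord n)  ≈⟨ π-tup n (coord n) i ⟩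
    coord n (toℕ i)          ≡⟨ coord-toℕ n i ⟩
    π n i                    ≈⟨ identityʳ _ ⟨
    π n i ∘ id               ∎

  coord-tup : ∀ {n k W X} → k ≤ n → (x : Seq W X) → coord n k ∘ tup n x ≈ x k
  coord-tup {n} {k} k≤n x = ≈.trans (π-tup n x (clamp n k)) (≈.reflexive (≡.cong x (toℕ-clamp k≤n)))

  τ : ∀ n {W X Y} → X ⇒ Y → Seq W X → W ⇒ Y
  τ n f x = t n f ∘ tup n x

  τ-cong : ∀ n {W X Y} {f g : X ⇒ Y} {x y : Seq W X} → f ≈ g → (∀ k → x k ≈ y k) →
           τ n f x ≈ τ n g y
  τ-cong n p q = ∘-cong (t-cong n p) (tup-cong n q)

  τ-congʳ : ∀ n {W X Y} (f : X ⇒ Y) {x y : Seq W X} → (∀ k → x k ≈ y k) → τ n f x ≈ τ n f y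
  τ-congʳ n f = τ-cong n ≈.refl

  τ-coord : ∀ n {X Y} (f : X ⇒ Y) → τ n f (coord n) ≈ t n f
  τ-coord n f = ≈.trans (t n f ∘⟩ tup-coord n) (identityʳ _)

  τ-linear : ∀ n {W X Y Z} (g : Y ⇒ Z) {h : X ⇒ Y} → IsLinear h → (x : Seq W X) →
             τ n (g ∘ h) x ≈ τ n g (λ k → h ∘ x k)
  τ-linear n g {h} p x = begin
    t n (g ∘ h) ∘ tup n x           ≈⟨ t-∘-linear n g p ⟨∘ _ ⟩
    (t n g ∘ Sₙ₁ n h) ∘ tup n x     ≈⟨ assoc _ _ _ ⟩
    t n g ∘ Sₙ₁ n h ∘ tup n x
      ≈⟨ t n g ∘⟩ ≈.trans (tuple-∘ n _ _) (tuple-cong n λ i →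
           ≈.trans (assoc _ _ _) (h ∘⟩ π-tup n x i)) ⟩
    τ n g (λ k → h ∘ x k)           ∎

  -- Transports an equation of order 0 to every order `n`, since `t n` acts entry by entry on linear
  -- maps. It carries the axioms `D-flip` and `D-lift` over to jets.
  τ-pointwise : ∀ n {V W X X′ Y} {g : X ⇒ Y} {g′ : X′ ⇒ Y} {h : V ⇒ X} {h′ : V ⇒ X′} →
                IsLinear h → IsLinear h′ → g ∘ h ≈ g′ ∘ h′ → (z : Seq W V) →
                τ n g (λ k → h ∘ z k) ≈ τ n g′ (λ k → h′ ∘ z k)
  τ-pointwise n {g = g} {g′} p p′ eq z =
    ≈.trans (≈.sym (τ-linear n g p z)) (≈.trans (t-cong n eq ⟨∘ _) (τ-linear n g′ p′ z))

  -- The recursion for coefficients along a jet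

  -- The velocity of the curve Σ xₖ εᵏ, divided by n + 1.
  step : ∀ n {W X} → Seq W X → Seq W X
  step n x k = (suc k ÷ suc n) · x (suc k)

  ν-tup : ∀ n {W X} (x : Seq W X) → ν n ∘ tup (suc n) x ≈ ⟨ tup n x , tup n (step n x) ⟩
  ν-tup n x = begin
    ν n ∘ tup (suc n) x    ≈⟨ ⟨,⟩-∘ _ _ _ ⟩
    ⟨ tuple n (λ i → π (suc n) (inject₁ i)) ∘ tup (suc n) x
    , tuple n (λ i → (suc (toℕ i) ÷ suc n) · π (suc n) (suc i)) ∘ tup (suc n) x ⟩
      ≈⟨ ⟨,⟩-cong
           (≈.trans (tuple-∘ n _ _) (tuple-cong n λ i →
             ≈.trans (π-tup (suc n) x (inject₁ i)) (≈.reflexive (≡.cong x (Fin.toℕ-inject₁ i)))))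
           (≈.trans (tuple-∘ n _ _) (tuple-cong n λ i →
             ≈.trans (·-∘ _ _ _) (·-congˡ _ (π-tup (suc n) x (suc i))))) ⟩
    ⟨ tup n x , tup n (step n x) ⟩ ∎

  infix 8 _&_
  _&_ : ∀ {W X} → Seq W X → Seq W X → Seq W (S X)
  (x & u) k = ⟨ x k , u k ⟩

  step-& : ∀ n {W X} (x u : Seq W X) k → step n (x & u) k ≈ (step n x & step n u) k
  step-& n x u k = ≈.sym (⟨,⟩-· _ _ _)

  -- Symmetry of second derivatives: `D-flip` exchanges the direction `u` with the velocity
  -- `step n x`, after which the induction hypothesis moves `D` inside `t n`.
  D-t : ∀ n {W X Y} (f : X ⇒ Y) (x u : Seq W X) →
        D (t n f) ∘ ⟨ tup n x , tup n u ⟩ ≈ τ n (D f) (x & u)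
  D-t zero    f x u = ≈.refl
  D-t (suc n) {W} {X} f x u = begin
    D (D (t n f) ∘ ν n) ∘ ⟨ tup (suc n) x , tup (suc n) u ⟩
      ≈⟨ D-∘-linear (D (t n f)) (ν-linear n) _ _ ⟩
    D (D (t n f)) ∘ ⟨ ν n ∘ tup (suc n) x , ν n ∘ tup (suc n) u ⟩
      ≈⟨ _ ∘⟩ ⟨,⟩-cong (ν-tup n x) (ν-tup n u) ⟩
    D (D (t n f)) ∘ ⟨ ⟨ tup n x , tup n (step n x) ⟩ , ⟨ tup n u , tup n (step n u) ⟩ ⟩
      ≈⟨ D-flip _ _ _ _ _ ⟩
    D (D (t n f)) ∘ ⟨ ⟨ tup n x , tup n u ⟩ , ⟨ tup n (step n x) , tup n (step n u) ⟩ ⟩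
      ≈⟨ _ ∘⟩ ⟨,⟩-cong (unzip-tup x u) (unzip-tup (step n x) (step n u)) ⟨
    D (D (t n f)) ∘ ⟨ unzip ∘ tup n (x & u) , unzip ∘ tup n (step n x & step n u) ⟩
      ≈⟨ D-∘-linear (D (t n f)) unzip-linear _ _ ⟨
    D (D (t n f) ∘ unzip) ∘ ⟨ tup n (x & u) , tup n (step n x & step n u) ⟩
      ≈⟨ ∘-cong (D-cong generic) (⟨,⟩-cong ≈.refl (tup-cong n λ k → ≈.sym (step-& n x u k))) ⟩
    D (t n (D f)) ∘ ⟨ tup n (x & u) , tup n (step n (x & u)) ⟩
      ≈⟨ D (t n (D f)) ∘⟩ ν-tup n (x & u) ⟨
    D (t n (D f)) ∘ ν n ∘ tup (suc n) (x & u)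
      ≈⟨ assoc _ _ _ ⟨
    τ (suc n) (D f) (x & u)
      ∎
    where
    x′ u′ : Seq (Sₙ n (S X)) X
    x′ k = π₀ ∘ coord n k
    u′ k = π₁ ∘ coord n k

    unzip : Sₙ n (S X) ⇒ S (Sₙ n X)
    unzip = ⟨ tup n x′ , tup n u′ ⟩

    unzip-linear : IsLinear unzip
    unzip-linear = ⟨,⟩-linear (tuple-linear n λ i → ∘-linear π₀-linear (coord-linear n (toℕ i)))
                              (tuple-linear n λ i → ∘-linear π₁-linear (coord-linear n (toℕ i)))

    unzip-tup : (x u : Seq W X) → unzip ∘ tup n (x & u) ≈ ⟨ tup n x , tup n u ⟩
    unzip-tup x u = ≈.trans (⟨,⟩-∘ _ _ _) (⟨,⟩-cong
      (≈.trans (tuple-∘ n _ _) (tuple-cong n λ i → ≈.trans (assoc _ _ _)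
        (≈.trans (π₀ ∘⟩ coord-tup (Fin.toℕ≤pred[n] i) (x & u)) (π₀-⟨,⟩ _ _))))
      (≈.trans (tuple-∘ n _ _) (tuple-cong n λ i → ≈.trans (assoc _ _ _)
        (≈.trans (π₁ ∘⟩ coord-tup (Fin.toℕ≤pred[n] i) (x & u)) (π₁-⟨,⟩ _ _)))))

    -- The induction hypothesis speaks of jets but is needed under `D`, as an identity of morphisms;
    -- hence it is taken at the generic jet of pairs.
    generic : D (t n f) ∘ unzip ≈ t n (D f)
    generic = begin
      D (t n f) ∘ unzip         ≈⟨ D-t n f x′ u′ ⟩
      τ n (D f) (x′ & u′)       ≈⟨ τ-congʳ n (D f) {coord n} (λ k → ⟨π₀,π₁⟩-η _) ⟨
      τ n (D f) (coord n)       ≈⟨ τ-coord n (D f) ⟩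
      t n (D f)                 ∎

  -- `t (suc n) f` differentiates outermost; here the new derivative falls on `f` itself, so
  -- inductions on `n` can run with `f` replaced by `D f`.
  τ-suc : ∀ n {W X Y} (f : X ⇒ Y) (x : Seq W X) → τ (suc n) f x ≈ τ n (D f) (x & step n x)
  τ-suc n f x = begin
    (D (t n f) ∘ ν n) ∘ tup (suc n) x               ≈⟨ assoc _ _ _ ⟩
    D (t n f) ∘ ν n ∘ tup (suc n) x                 ≈⟨ D (t n f) ∘⟩ ν-tup n x ⟩
    D (t n f) ∘ ⟨ tup n x , tup n (step n x) ⟩      ≈⟨ D-t n f x (step n x) ⟩
    τ n (D f) (x & step n x)                        ∎

  τ-D-+ : ∀ n {W X Y} (f : X ⇒ Y) (x u v : Seq W X) →
          τ n (D f) (x & (λ k → u k + v k)) ≈ τ n (D f) (x & u) + τ n (D f) (x & v)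
  τ-D-+ n f x u v = begin
    τ n (D f) (x & (λ k → u k + v k))                        ≈⟨ D-t n f x (λ k → u k + v k) ⟨
    D (t n f) ∘ ⟨ tup n x , tup n (λ k → u k + v k) ⟩        ≈⟨ _ ∘⟩ ⟨,⟩-cong ≈.refl (tuple-+ n _ _) ⟩
    D (t n f) ∘ ⟨ tup n x , tup n u + tup n v ⟩              ≈⟨ Add.+ᴹ-homo (D-additive₂ (t n f) _) _ _ ⟩
    D (t n f) ∘ ⟨ tup n x , tup n u ⟩ + D (t n f) ∘ ⟨ tup n x , tup n v ⟩
                                                             ≈⟨ Mod.+ᴹ-cong (D-t n f x u) (D-t n f x v) ⟩
    τ n (D f) (x & u) + τ n (D f) (x & v)                    ∎

  τ-D-· : ∀ n {W X Y} (f : X ⇒ Y) a (x u : Seq W X) →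
          τ n (D f) (x & (λ k → a · u k)) ≈ a · τ n (D f) (x & u)
  τ-D-· n f a x u = begin
    τ n (D f) (x & (λ k → a · u k))                  ≈⟨ D-t n f x (λ k → a · u k) ⟨
    D (t n f) ∘ ⟨ tup n x , tup n (λ k → a · u k) ⟩  ≈⟨ _ ∘⟩ ⟨,⟩-cong ≈.refl (tuple-· n a _) ⟩
    D (t n f) ∘ ⟨ tup n x , a · tup n u ⟩            ≈⟨ Add.*ₗ-homo (D-additive₂ (t n f) _) a _ ⟩
    a · (D (t n f) ∘ ⟨ tup n x , tup n u ⟩)          ≈⟨ ·-congˡ a (D-t n f x u) ⟩
    a · τ n (D f) (x & u)                            ∎

  τ-D-𝟘 : ∀ n {W X Y} (f : X ⇒ Y) (x : Seq W X) → τ n (D f) (x & (λ _ → 𝟘)) ≈ 𝟘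
  τ-D-𝟘 n f x = begin
    τ n (D f) (x & (λ _ → 𝟘))                    ≈⟨ D-t n f x (λ _ → 𝟘) ⟨
    D (t n f) ∘ ⟨ tup n x , tup n (λ _ → 𝟘) ⟩    ≈⟨ _ ∘⟩ ⟨,⟩-cong ≈.refl (tuple-𝟘 n) ⟩
    D (t n f) ∘ ⟨ tup n x , 𝟘 ⟩                  ≈⟨ Add.0ᴹ-homo (D-additive₂ (t n f) _) ⟩
    𝟘                                            ∎

  -- The lift and flip axioms for jets

  -- Extends `D-lift` to arbitrary `v`: a flip moves `v` into the additive argument, where ⟨ v , 𝟘 ⟩
  -- splits off, and a second flip turns that summand into a derivative in direction `𝟘`.
  D-D-lift : ∀ {W X Y} (f : X ⇒ Y) (x v w : W ⇒ X) →
             D (D f) ∘ ⟨ ⟨ x , v ⟩ , ⟨ 𝟘 , w ⟩ ⟩ ≈ D f ∘ ⟨ x , w ⟩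
  D-D-lift f x v w = begin
    D (D f) ∘ ⟨ ⟨ x , v ⟩ , ⟨ 𝟘 , w ⟩ ⟩                  ≈⟨ D-flip f x v 𝟘 w ⟩
    D (D f) ∘ ⟨ ⟨ x , 𝟘 ⟩ , ⟨ v , w ⟩ ⟩
      ≈⟨ _ ∘⟩ ⟨,⟩-cong ≈.refl (≈.trans
           (⟨,⟩-cong (≈.sym (Mod.+ᴹ-identityʳ v)) (≈.sym (Mod.+ᴹ-identityˡ w))) (⟨,⟩-+ v 𝟘 𝟘 w)) ⟩
    D (D f) ∘ ⟨ ⟨ x , 𝟘 ⟩ , ⟨ v , 𝟘 ⟩ + ⟨ 𝟘 , w ⟩ ⟩
      ≈⟨ Add.+ᴹ-homo (D-additive₂ (D f) _) _ _ ⟩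
    D (D f) ∘ ⟨ ⟨ x , 𝟘 ⟩ , ⟨ v , 𝟘 ⟩ ⟩ + D (D f) ∘ ⟨ ⟨ x , 𝟘 ⟩ , ⟨ 𝟘 , w ⟩ ⟩
      ≈⟨ Mod.+ᴹ-cong vertical (D-lift f x w) ⟩
    𝟘 + D f ∘ ⟨ x , w ⟩                                  ≈⟨ Mod.+ᴹ-identityˡ _ ⟩
    D f ∘ ⟨ x , w ⟩                                      ∎
    where
    vertical : D (D f) ∘ ⟨ ⟨ x , 𝟘 ⟩ , ⟨ v , 𝟘 ⟩ ⟩ ≈ 𝟘
    vertical = begin
      D (D f) ∘ ⟨ ⟨ x , 𝟘 ⟩ , ⟨ v , 𝟘 ⟩ ⟩    ≈⟨ D-flip f x 𝟘 v 𝟘 ⟩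
      D (D f) ∘ ⟨ ⟨ x , v ⟩ , ⟨ 𝟘 , 𝟘 ⟩ ⟩    ≈⟨ _ ∘⟩ ⟨,⟩-cong ≈.refl ⟨,⟩-𝟘 ⟩
      D (D f) ∘ ⟨ ⟨ x , v ⟩ , 𝟘 ⟩            ≈⟨ Add.0ᴹ-homo (D-additive₂ (D f) _) ⟩
      𝟘                                      ∎

  module _ {X : Obj} where
    π₀₀ π₀₁ π₁₀ π₁₁ : S (S X) ⇒ X
    π₀₀ = π₀ ∘ π₀
    π₀₁ = π₁ ∘ π₀
    π₁₀ = π₀ ∘ π₁
    π₁₁ = π₁ ∘ π₁

    π₀₀-linear : IsLinear π₀₀
    π₀₀-linear = ∘-linear π₀-linear π₀-linear

    π₀₁-linear : IsLinear π₀₁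
    π₀₁-linear = ∘-linear π₁-linear π₀-linear

    π₁₀-linear : IsLinear π₁₀
    π₁₀-linear = ∘-linear π₀-linear π₁-linear

    π₁₁-linear : IsLinear π₁₁
    π₁₁-linear = ∘-linear π₁-linear π₁-linear

    module _ {W : Obj} (x u v w : W ⇒ X) where
      π₀₀-⟨,⟩ : π₀₀ ∘ ⟨ ⟨ x , u ⟩ , ⟨ v , w ⟩ ⟩ ≈ x
      π₀₀-⟨,⟩ = ≈.trans (assoc _ _ _) (≈.trans (π₀ ∘⟩ π₀-⟨,⟩ _ _) (π₀-⟨,⟩ _ _))

      π₀₁-⟨,⟩ : π₀₁ ∘ ⟨ ⟨ x , u ⟩ , ⟨ v , w ⟩ ⟩ ≈ u
      π₀₁-⟨,⟩ = ≈.trans (assoc _ _ _) (≈.trans (π₁ ∘⟩ π₀-⟨,⟩ _ _) (π₁-⟨,⟩ _ _))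

      π₁₀-⟨,⟩ : π₁₀ ∘ ⟨ ⟨ x , u ⟩ , ⟨ v , w ⟩ ⟩ ≈ v
      π₁₀-⟨,⟩ = ≈.trans (assoc _ _ _) (≈.trans (π₀ ∘⟩ π₁-⟨,⟩ _ _) (π₀-⟨,⟩ _ _))

      π₁₁-⟨,⟩ : π₁₁ ∘ ⟨ ⟨ x , u ⟩ , ⟨ v , w ⟩ ⟩ ≈ w
      π₁₁-⟨,⟩ = ≈.trans (assoc _ _ _) (≈.trans (π₁ ∘⟩ π₁-⟨,⟩ _ _) (π₁-⟨,⟩ _ _))

  ⟨⟨,⟩,⟨,⟩⟩-∘ : ∀ {V W X} (a b c d : W ⇒ X) (z : V ⇒ W) →
                ⟨ ⟨ a , b ⟩ , ⟨ c , d ⟩ ⟩ ∘ z ≈ ⟨ ⟨ a ∘ z , b ∘ z ⟩ , ⟨ c ∘ z , d ∘ z ⟩ ⟩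
  ⟨⟨,⟩,⟨,⟩⟩-∘ a b c d z =
    ≈.trans (⟨,⟩-∘ _ _ z) (⟨,⟩-cong (⟨,⟩-∘ a b z) (⟨,⟩-∘ c d z))

  -- At the four projections of `S (S X)`, `D-flip` says that `D (D f)` equalizes `h`, an expanded
  -- identity, and `h′`, the exchange of the two middle components; `τ-pointwise` does the rest.
  τ-flip : ∀ n {W X Y} (f : X ⇒ Y) (x u v w : Seq W X) →
           τ n (D (D f)) ((x & u) & (v & w)) ≈ τ n (D (D f)) ((x & v) & (u & w))
  τ-flip n {X = X} f x u v w = begin
    τ n (D (D f)) z
      ≈⟨ τ-congʳ n _ {λ k → h ∘ z k} {z} (λ k → ≈.trans (⟨⟨,⟩,⟨,⟩⟩-∘ _ _ _ _ _) (⟨,⟩-cong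
           (⟨,⟩-cong (π₀₀-⟨,⟩ _ _ _ _) (π₀₁-⟨,⟩ _ _ _ _))
           (⟨,⟩-cong (π₁₀-⟨,⟩ _ _ _ _) (π₁₁-⟨,⟩ _ _ _ _)))) ⟨
    τ n (D (D f)) (λ k → h ∘ z k)
      ≈⟨ τ-pointwise n
           (⟨,⟩-linear (⟨,⟩-linear π₀₀-linear π₀₁-linear) (⟨,⟩-linear π₁₀-linear π₁₁-linear))
           (⟨,⟩-linear (⟨,⟩-linear π₀₀-linear π₁₀-linear) (⟨,⟩-linear π₀₁-linear π₁₁-linear))
           (D-flip f _ _ _ _) z ⟩
    τ n (D (D f)) (λ k → h′ ∘ z k)
      ≈⟨ τ-congʳ n _ {λ k → h′ ∘ z k} {(x & v) & (u & w)} (λ k → ≈.trans (⟨⟨,⟩,⟨,⟩⟩-∘ _ _ _ _ _) (⟨,⟩-cong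
           (⟨,⟩-cong (π₀₀-⟨,⟩ _ _ _ _) (π₁₀-⟨,⟩ _ _ _ _))
           (⟨,⟩-cong (π₀₁-⟨,⟩ _ _ _ _) (π₁₁-⟨,⟩ _ _ _ _)))) ⟩
    τ n (D (D f)) ((x & v) & (u & w))
      ∎
    where
    z = (x & u) & (v & w)
    h h′ : S (S X) ⇒ S (S X)
    h  = ⟨ ⟨ π₀₀ , π₀₁ ⟩ , ⟨ π₁₀ , π₁₁ ⟩ ⟩
    h′ = ⟨ ⟨ π₀₀ , π₁₀ ⟩ , ⟨ π₀₁ , π₁₁ ⟩ ⟩

  τ-lift : ∀ n {W X Y} (f : X ⇒ Y) (x v w : Seq W X) →
           τ n (D (D f)) ((x & v) & ((λ _ → 𝟘) & w)) ≈ τ n (D f) (x & w)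
  τ-lift n {X = X} f x v w = begin
    τ n (D (D f)) z
      ≈⟨ τ-congʳ n _ {λ k → h ∘ z k} {z} (λ k → ≈.trans (⟨⟨,⟩,⟨,⟩⟩-∘ _ _ _ _ _) (⟨,⟩-cong
           (⟨,⟩-cong (π₀₀-⟨,⟩ _ _ _ _) (π₀₁-⟨,⟩ _ _ _ _))
           (⟨,⟩-cong (𝟘-∘ _) (π₁₁-⟨,⟩ _ _ _ _)))) ⟨
    τ n (D (D f)) (λ k → h ∘ z k)
      ≈⟨ τ-pointwise n
           (⟨,⟩-linear (⟨,⟩-linear π₀₀-linear π₀₁-linear) (⟨,⟩-linear 𝟘-linear π₁₁-linear))
           (⟨,⟩-linear π₀₀-linear π₁₁-linear)
           (D-D-lift f _ _ _) z ⟩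
    τ n (D f) (λ k → h′ ∘ z k)
      ≈⟨ τ-congʳ n _ {λ k → h′ ∘ z k} {x & w} (λ k → ≈.trans (⟨,⟩-∘ _ _ _)
           (⟨,⟩-cong (π₀₀-⟨,⟩ _ _ _ _) (π₁₁-⟨,⟩ _ _ _ _))) ⟩
    τ n (D f) (x & w)
      ∎
    where
    z = (x & v) & ((λ _ → 𝟘) & w)
    -- Here `h` is not the identity: it replaces `π₁₀` by `𝟘`, which does not change `z`.
    h : S (S X) ⇒ S (S X)
    h  = ⟨ ⟨ π₀₀ , π₀₁ ⟩ , ⟨ 𝟘 , π₁₁ ⟩ ⟩
    h′ : S (S X) ⇒ S X
    h′ = ⟨ π₀₀ , π₁₁ ⟩

  -- Dividing a tangent jet by the formal parameter

  𝟎 : ∀ {W X} → Seq W X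
  𝟎 _ = 𝟘

  -- Multiplication of Σ uₖ εᵏ by ε.
  shift : ∀ {W X} → Seq W X → Seq W X
  shift u zero    = 𝟘
  shift u (suc k) = u k

  -- The velocity of `x & u` is the sum of the velocity of `x` and that of `u`. The first summand
  -- gives a genuine second derivative, written with `u` as the outer direction; the second
  -- collapses to a first derivative by `τ-lift`.
  τ-suc-D : ∀ n {W X Y} (f : X ⇒ Y) (x u : Seq W X) →
            τ (suc n) (D f) (x & u)
              ≈ τ n (D (D f)) ((x & step n x) & (u & 𝟎)) + τ n (D f) (x & step n u)
  τ-suc-D n f x u = begin
    τ (suc n) (D f) (x & u)
      ≈⟨ τ-suc n (D f) (x & u) ⟩
    τ n (D (D f)) ((x & u) & step n (x & u))
      ≈⟨ τ-congʳ n (D (D f)) {(x & u) & step n (x & u)} {(x & u) & sum}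
           (λ k → ⟨,⟩-cong ≈.refl (≈.trans (step-& n x u k) (≈.trans (⟨,⟩-cong (≈.sym (Mod.+ᴹ-identityʳ _)) (≈.sym (Mod.+ᴹ-identityˡ _)))
             (⟨,⟩-+ _ _ _ _)))) ⟩
    τ n (D (D f)) ((x & u) & sum)
      ≈⟨ τ-D-+ n (D f) (x & u) (step n x & 𝟎) (𝟎 & step n u) ⟩
    τ n (D (D f)) ((x & u) & (step n x & 𝟎)) + τ n (D (D f)) ((x & u) & (𝟎 & step n u))
      ≈⟨ Mod.+ᴹ-cong (τ-flip n f x u (step n x) 𝟎) (τ-lift n f x u (step n u)) ⟩
    τ n (D (D f)) ((x & step n x) & (u & 𝟎)) + τ n (D f) (x & step n u)
      ∎
    where
    sum = λ k → (step n x & 𝟎) k + (𝟎 & step n u) k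

  suc-÷ : ∀ k n → suc k ÷ suc n R.≈ (k ÷ suc n) R.+ (1/ suc n)
  suc-÷ k n = R.trans (R.distribʳ _ _ _) (R.trans (R.+-comm _ _) (R.+-congˡ (R.*-identityˡ _)))

  -- At 1 + m the first-order part of the left side involves (k + 1)/(m + 2) · uₖ, which splits as
  -- (m + 1)/(m + 2) · k/(m + 1) · uₖ + 1/(m + 2) · uₖ; the first summand completes the
  -- second-order part to the expansion of the right side, so nothing has to be cancelled.
  τ-shift : ∀ n {W X Y} (f : X ⇒ Y) (x u : Seq W X) →
            τ (suc n) (D f) (x & shift u) ≈ τ n (D f) (x & u)
  τ-shift zero f x u = begin
    τ 1 (D f) (x & shift u)
      ≈⟨ τ-suc-D 0 f x (shift u) ⟩
    D (D f) ∘ ⟨ ⟨ x 0 , step 0 x 0 ⟩ , ⟨ 𝟘 , 𝟘 ⟩ ⟩ + D f ∘ ⟨ x 0 , (1 ÷ 1) · u 0 ⟩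
      ≈⟨ Mod.+ᴹ-cong
           (≈.trans (_ ∘⟩ ⟨,⟩-cong ≈.refl ⟨,⟩-𝟘) (Add.0ᴹ-homo (D-additive₂ (D f) _)))
           (_ ∘⟩ ⟨,⟩-cong ≈.refl (≈.trans (·-congʳ _ (÷-self 1)) (Mod.*ₗ-identityˡ _))) ⟩
    𝟘 + D f ∘ ⟨ x 0 , u 0 ⟩
      ≈⟨ Mod.+ᴹ-identityˡ _ ⟩
    D f ∘ ⟨ x 0 , u 0 ⟩
      ∎
  τ-shift (suc m) {W} {X} f x u = begin
    τ (suc M) (D f) (x & shift u)                    ≈⟨ τ-suc-D M f x (shift u) ⟩
    τ M (D (D f)) ((x & step M x) & (shift u & 𝟎)) + Q (step M (shift u))
                                                     ≈⟨ Mod.+ᴹ-cong second-order first-order ⟩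
    α · A + (α · Q w + β · Q u)                      ≈⟨ Mod.+ᴹ-assoc _ _ _ ⟨
    (α · A + α · Q w) + β · Q u                      ≈⟨ Mod.+ᴹ-cong (Mod.*ₗ-distribˡ α A (Q w)) ≈.refl ⟨
    α · (A + Q w) + β · Q u                          ≈⟨ Mod.+ᴹ-cong (·-congˡ α expand) ≈.refl ⟨
    α · Q u + β · Q u                                ≈⟨ Mod.*ₗ-distribʳ _ _ _ ⟨
    (α R.+ β) · Q u                                  ≈⟨ ·-congʳ _ (suc-÷ M M) ⟨
    (suc M ÷ suc M) · Q u                            ≈⟨ ·-congʳ _ (÷-self (suc M)) ⟩
    R.1# · Q u                                       ≈⟨ Mod.*ₗ-identityˡ _ ⟩
    Q u                                              ∎
    where
    M = suc m
    α = M ÷ suc M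
    β = 1/ suc M

    Q : Seq W X → _
    Q v = τ M (D f) (x & v)

    A = τ m (D (D f)) ((x & step m x) & (u & 𝟎))

    -- The Euler operator ε d/dε applied to `u`, divided by `M`; its entry at 0 vanishes, so it is
    -- the shift of `step m u`.
    w : Seq W X
    w k = (k ÷ M) · u k

    shift-& : ∀ k → (shift u & 𝟎) k ≈ shift (u & 𝟎) k
    shift-& zero    = ⟨,⟩-𝟘
    shift-& (suc k) = ≈.refl

    shift-step : ∀ k → shift (step m u) k ≈ w k
    shift-step zero    = ≈.sym (≈.trans (·-congʳ _ (R.zeroˡ _)) (Mod.*ₗ-zeroˡ _))
    shift-step (suc k) = ≈.refl

    rescale : ∀ k (v : W ⇒ X) → (k ÷ suc M) · v ≈ α · ((k ÷ M) · v)
    rescale k v = ≈.trans (·-congʳ v (R.sym (÷-* k M (suc M)))) (Mod.*ₗ-assoc _ _ _)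

    second-order : τ M (D (D f)) ((x & step M x) & (shift u & 𝟎)) ≈ α · A
    second-order = begin
      τ M (D (D f)) ((x & step M x) & (shift u & 𝟎))
        ≈⟨ τ-congʳ M (D (D f)) {(x & step M x) & (shift u & 𝟎)} {(x & step M x) & shift (u & 𝟎)}
             (λ k → ⟨,⟩-cong ≈.refl (shift-& k)) ⟩
      τ M (D (D f)) ((x & step M x) & shift (u & 𝟎))
        -- `𝟎` is its own shift, so the induction hypothesis applies to `D f` and jets of pairs.
        ≈⟨ τ-shift m (D f) (x & step M x) (u & 𝟎) ⟩
      τ m (D (D f)) ((x & step M x) & (u & 𝟎))
        -- The factor `α` between `step M x` and `step m x` can be extracted only from the outer
        -- direction; one flip brings it there and a later one restores the order.
        ≈⟨ τ-flip m f x (step M x) u 𝟎 ⟩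
      τ m (D (D f)) ((x & u) & (step M x & 𝟎))
        ≈⟨ τ-congʳ m (D (D f)) {(x & u) & (step M x & 𝟎)} {(x & u) & (λ k → α · (step m x & 𝟎) k)}
             (λ k → ⟨,⟩-cong ≈.refl (≈.trans
               (⟨,⟩-cong (rescale (suc k) (x (suc k))) (≈.sym (Mod.*ₗ-zeroʳ α))) (⟨,⟩-· α _ _))) ⟩
      τ m (D (D f)) ((x & u) & (λ k → α · (step m x & 𝟎) k))
        ≈⟨ τ-D-· m (D f) α (x & u) (step m x & 𝟎) ⟩
      α · τ m (D (D f)) ((x & u) & (step m x & 𝟎))
        ≈⟨ ·-congˡ α (τ-flip m f x u (step m x) 𝟎) ⟩
      α · A
        ∎

    first-order : Q (step M (shift u)) ≈ α · Q w + β · Q u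
    first-order = begin
      Q (step M (shift u))
        ≈⟨ τ-congʳ M (D f) {x & step M (shift u)} {x & (λ k → α · w k + β · u k)}
             (λ k → ⟨,⟩-cong ≈.refl (≈.trans (·-congʳ (u k) (suc-÷ k M))
               (≈.trans (Mod.*ₗ-distribʳ _ _ _) (Mod.+ᴹ-cong (rescale k (u k)) ≈.refl)))) ⟩
      Q (λ k → α · w k + β · u k)
        ≈⟨ τ-D-+ M f x (λ k → α · w k) (λ k → β · u k) ⟩
      Q (λ k → α · w k) + Q (λ k → β · u k)
        ≈⟨ Mod.+ᴹ-cong (τ-D-· M f α x w) (τ-D-· M f β x u) ⟩
      α · Q w + β · Q u
        ∎

    -- The right side is expanded by the same rule as the left; the induction hypothesis, used
    -- backwards, raises the order of its first-order part from `m` to `M`.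
    expand : Q u ≈ A + Q w
    expand = begin
      Q u                                ≈⟨ τ-suc-D m f x u ⟩
      A + τ m (D f) (x & step m u)       ≈⟨ Mod.+ᴹ-cong ≈.refl (τ-shift m f x (step m u)) ⟨
      A + Q (shift (step m u))
        ≈⟨ Mod.+ᴹ-cong ≈.refl (τ-congʳ M (D f) {x & shift (step m u)} {x & w}
             (λ k → ⟨,⟩-cong ≈.refl (shift-step k))) ⟩
      A + Q w                            ∎

  -- Diagonal jets

  kron : ∀ {X Y} (i j : ℕ) → X ⇒ Y → X ⇒ Y
  kron i j f = if does (i ≟ j) then f else 𝟘

  kron-cong : ∀ {X Y} i j {f g : X ⇒ Y} → (i ≡ j → f ≈ g) → kron i j f ≈ kron i j g
  -- `does (i ≟ j)` computes to `i ≡ᵇ j`, so abstracting the latter lets `kron` reduce.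
  kron-cong i j p with i ≡ᵇ j | ℕ.≡ᵇ⇒≡ i j
  ... | true  | eq = p (eq tt)
  ... | false | _  = ≈.refl

  kron-homo : ∀ {X Y X′ Y′} i j (h : X ⇒ Y → X′ ⇒ Y′) → h 𝟘 ≈ 𝟘 → (f : X ⇒ Y) →
              h (kron i j f) ≈ kron i j (h f)
  kron-homo i j h p f with i ≡ᵇ j
  ... | true  = ≈.refl
  ... | false = p

  kron-⟨,⟩ : ∀ {W X} i j (f g : W ⇒ X) → ⟨ kron i j f , kron i j g ⟩ ≈ kron i j ⟨ f , g ⟩
  kron-⟨,⟩ i j f g with i ≡ᵇ j
  ... | true  = ≈.refl
  ... | false = ⟨,⟩-𝟘

  -- The coefficient of εᵇ δᵃ in Σ xₖ (ε δ)ᵏ, with δ a second formal parameter.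
  diag : ∀ {W X} → Seq W X → ℕ → Seq W X
  diag x a b = kron b a (x b)

  τ-const : ∀ n {W X Y} (f : X ⇒ Y) (x : Seq W X) → (∀ k → x (suc k) ≈ 𝟘) → τ (suc n) f x ≈ 𝟘
  τ-const n f x p = begin
    τ (suc n) f x              ≈⟨ τ-suc n f x ⟩
    τ n (D f) (x & step n x)
      ≈⟨ τ-congʳ n (D f) {x & step n x} {x & 𝟎} (λ k → ⟨,⟩-cong ≈.refl
           (≈.trans (·-congˡ _ (p k)) (Mod.*ₗ-zeroʳ _))) ⟩
    τ n (D f) (x & 𝟎)          ≈⟨ τ-D-𝟘 n f x ⟩
    𝟘                          ∎

  -- Differentiate in δ: row a + 1 of the diagonal has no entry in column 0, so the velocity is
  -- divisible by ε and `τ-shift` lowers the inner order too. What remains is the diagonal of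
  -- `x & step j x`, to which induction applies for `D f`.
  τ-diag : ∀ i j {W X Y} (f : X ⇒ Y) (x : Seq W X) →
           τ j (t i f) (λ a → tup i (diag x a)) ≈ kron i j (τ i f x)
  τ-diag zero    zero    f x = ≈.refl
  -- If one index is zero, only the entry at (0, 0) survives, and the curve is constant in the other
  -- parameter.
  τ-diag zero    (suc j) f x = τ-const j f (λ a → diag x a 0) (λ _ → ≈.refl)
  τ-diag (suc i) zero    f x = τ-const i f (diag x 0) (λ _ → ≈.refl)
  τ-diag (suc i) (suc j) {W} {X} f x = begin
    τ (suc j) (t (suc i) f) y                     ≈⟨ τ-suc j _ y ⟩
    τ j (D (t (suc i) f)) (y & step j y)          ≈⟨ τ-congʳ j _ {λ a → h ∘ c a} {y & step j y} h∘c ⟨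
    τ j (D (t (suc i) f)) (λ a → h ∘ c a)         ≈⟨ τ-pointwise j h-linear h′-linear divide c ⟩
    τ j (t i (D f)) (λ a → h′ ∘ c a)
      ≈⟨ τ-congʳ j _ {λ a → h′ ∘ c a} {λ a → tup i (diag (x & step j x) a)} h′∘c ⟩
    τ j (t i (D f)) (λ a → tup i (diag (x & step j x) a))
                                                  ≈⟨ τ-diag i j (D f) (x & step j x) ⟩
    kron i j (τ i (D f) (x & step j x))
      -- `τ-suc` requires `step i x`, not `step j x`; they need to agree only for `i ≡ j`, the case
      -- that `kron` keeps.
      ≈⟨ kron-cong i j (λ { ≡.refl → τ-suc i f x }) ⟨
    kron i j (τ (suc i) f x)                      ∎
    where
    y : Seq W (Sₙ (suc i) X)
    y a = tup (suc i) (diag x a)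

    p q : Seq (S (Sₙ (suc i) X)) X
    p k = coord (suc i) k ∘ π₀
    q k = coord (suc i) k ∘ π₁

    p-linear : ∀ k → IsLinear (p k)
    p-linear k = ∘-linear (coord-linear (suc i) k) π₀-linear

    q-linear : ∀ k → IsLinear (q k)
    q-linear k = ∘-linear (coord-linear (suc i) k) π₁-linear

    shift-q-linear : ∀ k → IsLinear (shift q k)
    shift-q-linear zero    = 𝟘-linear
    shift-q-linear (suc k) = q-linear k

    -- `h` multiplies the second curve by ε, while `h′` pairs the curves and truncates them to order
    -- `i`. `τ-shift` at generic curves compares the two as morphisms, as `τ-pointwise` demands.
    h : S (Sₙ (suc i) X) ⇒ S (Sₙ (suc i) X)
    h = ⟨ tup (suc i) p , tup (suc i) (shift q) ⟩

    h-linear : IsLinear h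
    h-linear = ⟨,⟩-linear (tuple-linear (suc i) λ k → p-linear (toℕ k))
                          (tuple-linear (suc i) λ k → shift-q-linear (toℕ k))

    h′ : S (Sₙ (suc i) X) ⇒ Sₙ i (S X)
    h′ = tup i (p & q)

    h′-linear : IsLinear h′
    h′-linear = tuple-linear i λ k → ⟨,⟩-linear (p-linear (toℕ k)) (q-linear (toℕ k))

    divide : D (t (suc i) f) ∘ h ≈ t i (D f) ∘ h′
    divide = ≈.trans (D-t (suc i) f p (shift q)) (τ-shift i f p q)

    -- The velocity `step j y` divided by ε.
    v : ℕ → Seq W X
    v a k = (suc a ÷ suc j) · diag x (suc a) (suc k)

    c : Seq W (S (Sₙ (suc i) X))
    c a = ⟨ y a , tup (suc i) (v a) ⟩

    p∘c : ∀ a {k} → k ≤ suc i → p k ∘ c a ≈ diag x a k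
    p∘c a k≤i = ≈.trans (assoc _ _ _) (≈.trans (_ ∘⟩ π₀-⟨,⟩ _ _) (coord-tup k≤i (diag x a)))

    q∘c : ∀ a {k} → k ≤ suc i → q k ∘ c a ≈ v a k
    q∘c a k≤i = ≈.trans (assoc _ _ _) (≈.trans (_ ∘⟩ π₁-⟨,⟩ _ _) (coord-tup k≤i (v a)))

    shift-q∘c : ∀ a (k : Fin (suc (suc i))) →
                shift q (toℕ k) ∘ c a ≈ (suc a ÷ suc j) · diag x (suc a) (toℕ k)
    shift-q∘c a zero    = ≈.trans (𝟘-∘ _) (≈.sym (Mod.*ₗ-zeroʳ _))
    shift-q∘c a (suc k) = q∘c a (ℕ.m≤n⇒m≤1+n (Fin.toℕ≤pred[n] k))

    h∘c : ∀ a → h ∘ c a ≈ (y & step j y) a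
    h∘c a = ≈.trans (⟨,⟩-∘ _ _ _) (⟨,⟩-cong
      (≈.trans (tuple-∘ (suc i) _ _) (tuple-cong (suc i) λ k → p∘c a (Fin.toℕ≤pred[n] k)))
      (≈.trans (tuple-∘ (suc i) _ _) (≈.trans (tuple-cong (suc i) (shift-q∘c a))
        (tuple-· (suc i) _ _))))

    h′∘c : ∀ a → h′ ∘ c a ≈ tup i (diag (x & step j x) a)
    h′∘c a = ≈.trans (tuple-∘ i _ _) (tuple-cong i λ k → begin
      (p & q) (toℕ k) ∘ c a
        ≈⟨ ⟨,⟩-∘ _ _ _ ⟩
      ⟨ p (toℕ k) ∘ c a , q (toℕ k) ∘ c a ⟩
        ≈⟨ ⟨,⟩-cong (p∘c a (bound k)) (q∘c a (bound k)) ⟩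
      ⟨ diag x a (toℕ k) , (suc a ÷ suc j) · kron (toℕ k) a (x (suc (toℕ k))) ⟩
        ≈⟨ ⟨,⟩-cong ≈.refl (≈.trans
             (kron-homo (toℕ k) a ((suc a ÷ suc j) ·_) (Mod.*ₗ-zeroʳ _) _)
             -- Off the diagonal everything is `𝟘`, so the row weight (a + 1)/(j + 1) may be
             -- replaced by the column weight (k + 1)/(j + 1) of `step j x`.
             (kron-cong (toℕ k) a λ eq →
               ≈.reflexive (≡.cong (λ b → (suc b ÷ suc j) · x (suc (toℕ k))) (≡.sym eq)))) ⟩
      ⟨ kron (toℕ k) a (x (toℕ k)) , kron (toℕ k) a (step j x (toℕ k)) ⟩
        ≈⟨ kron-⟨,⟩ (toℕ k) a _ _ ⟩
      diag (x & step j x) a (toℕ k)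
        ∎)
      where
      bound : (k : Fin (suc i)) → toℕ k ≤ suc i
      bound k = ℕ.m≤n⇒m≤1+n (Fin.toℕ≤pred[n] k)

  -- The coordinates of `l` and its naturality

  does-toℕ-≟ : ∀ {n} (i j : Fin n) → does (i Fin.≟ j) ≡ does (toℕ i ≟ toℕ j)
  does-toℕ-≟ zero    zero    = ≡.refl
  does-toℕ-≟ zero    (suc j) = ≡.refl
  does-toℕ-≟ (suc i) zero    = ≡.refl
  does-toℕ-≟ (suc i) (suc j) = does-toℕ-≟ i j

  π-π-l : ∀ n {X} i j → π n i ∘ π n j ∘ l n {X} ≈ kron (toℕ i) (toℕ j) (π n i)
  π-π-l n i j = begin
    π n i ∘ π n j ∘ l n                                ≈⟨ π n i ∘⟩ π-tuple n _ j ⟩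
    π n i ∘ tuple n (λ i → if does (i Fin.≟ j) then π n i else 𝟘)
                                                       ≈⟨ π-tuple n _ i ⟩
    (if does (i Fin.≟ j) then π n i else 𝟘)
      ≡⟨ ≡.cong (if_then π n i else 𝟘) (does-toℕ-≟ i j) ⟩
    kron (toℕ i) (toℕ j) (π n i)                       ∎

  π-inject≤ : ∀ {m n X} .(m≤n : m ≤ n) i → π n {X} (inject≤ i (s≤s m≤n)) ≡ coord n (toℕ i)
  π-inject≤ {n = n} m≤n i = ≡.trans (≡.sym (coord-toℕ n _))
    (≡.cong (coord n) (Fin.toℕ-inject≤ i (s≤s m≤n)))

  s-tup : ∀ {m n X} .(m≤n : m ≤ n) → s {m} {n} {X} m≤n ≈ tup m (coord n)
  s-tup {m} m≤n = tuple-cong m λ i → ≈.reflexive (π-inject≤ m≤n i)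

  s-linear : ∀ {m n X} .(m≤n : m ≤ n) → IsLinear (s {m} {n} {X} m≤n)
  s-linear m≤n = D-s m≤n

  -- `l n` is the diagonal of the generic jet, and truncation merely forgets entries; this brings
  -- the formula into the form of `τ-diag`.
  s*s∘l : ∀ {i j n X} .(j≤n : j ≤ n) .(i≤n : i ≤ n) →
          s*s {i} {j} {n} {X} j≤n i≤n ∘ l n ≈ tup j (λ a → tup i (diag (coord n) a))
  s*s∘l {i} {j} {n} {X} j≤n i≤n = π-ext j _ _ λ a →
    let a′ = inject≤ a (s≤s j≤n) in begin
    π j a ∘ (Sₙ₁ j sᵢ ∘ sⱼ) ∘ l n            ≈⟨ π j a ∘⟩ assoc _ _ _ ⟩
    π j a ∘ Sₙ₁ j sᵢ ∘ sⱼ ∘ l n              ≈⟨ assoc _ _ _ ⟨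
    (π j a ∘ Sₙ₁ j sᵢ) ∘ sⱼ ∘ l n            ≈⟨ π-tuple j _ a ⟨∘ _ ⟩
    (sᵢ ∘ π j a) ∘ sⱼ ∘ l n                  ≈⟨ assoc _ _ _ ⟩
    sᵢ ∘ π j a ∘ sⱼ ∘ l n                    ≈⟨ sᵢ ∘⟩ assoc _ _ _ ⟨
    sᵢ ∘ (π j a ∘ sⱼ) ∘ l n                  ≈⟨ sᵢ ∘⟩ (π-s {j} {n} j≤n a ⟨∘ l n) ⟩
    sᵢ ∘ π n a′ ∘ l n
      ≈⟨ π-ext i _ _ (λ b →
           let b′ = inject≤ b (s≤s i≤n) in begin
           π i b ∘ sᵢ ∘ π n a′ ∘ l n                   ≈⟨ assoc _ _ _ ⟨
           (π i b ∘ sᵢ) ∘ π n a′ ∘ l n                 ≈⟨ π-s {i} {n} i≤n b ⟨∘ _ ⟩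
           π n b′ ∘ π n a′ ∘ l n                       ≈⟨ π-π-l n b′ a′ ⟩
           kron (toℕ b′) (toℕ a′) (π n b′)
             ≡⟨ ≡.cong (kron (toℕ b′) (toℕ a′)) (coord-toℕ n b′) ⟨
           diag (coord n) (toℕ a′) (toℕ b′)
             ≡⟨ ≡.cong₂ (diag (coord n)) (Fin.toℕ-inject≤ a (s≤s j≤n)) (Fin.toℕ-inject≤ b (s≤s i≤n)) ⟩
           diag (coord n) (toℕ a) (toℕ b)              ≈⟨ π-tup i (diag (coord n) (toℕ a)) b ⟨
           π i b ∘ tup i (diag (coord n) (toℕ a))      ∎) ⟩
    tup i (diag (coord n) (toℕ a))           ≈⟨ π-tup j (λ a → tup i (diag (coord n) a)) a ⟨
    π j a ∘ tup j (λ a → tup i (diag (coord n) a))    ∎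
    where
    sᵢ = s {i} {n} {X} i≤n
    sⱼ = s {j} {n} {Sₙ n X} j≤n

  t-t-l : ∀ n i j .(i≤n : i ≤ n) .(j≤n : j ≤ n) {X Y} (f : X ⇒ Y) →
          t j (t i f) ∘ s*s {i} {j} {n} {X} j≤n i≤n ∘ l n
            ≈ kron i j (t i f ∘ s {i} {n} {X} i≤n)
  t-t-l n i j i≤n j≤n f = begin
    t j (t i f) ∘ s*s {i} {j} {n} j≤n i≤n ∘ l n          ≈⟨ _ ∘⟩ s*s∘l {i} {j} {n} j≤n i≤n ⟩
    τ j (t i f) (λ a → tup i (diag (coord n) a))         ≈⟨ τ-diag i j f (coord n) ⟩
    kron i j (t i f ∘ tup i (coord n))
      ≈⟨ kron-cong i j (λ _ → t i f ∘⟩ s-tup {i} {n} i≤n) ⟨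
    kron i j (t i f ∘ s {i} {n} i≤n)                     ∎

  -- Compared coordinate by coordinate, both sides reduce to the two sides of `t-t-l`.
  l-natural : ∀ n → IsNaturalTransformation (T n) (T n ∘F T n) (λ X → l n {X})
  l-natural n {X} {Y} f = π-ext n _ _ λ j → π-ext n _ _ λ i →
    let i≤n = Fin.toℕ≤pred[n] i
        j≤n = Fin.toℕ≤pred[n] j
        sᵢ  = s {n = n} {X} i≤n
        sⱼ  = s {n = n} {Sₙ n X} j≤n
        tᵢ  = λ {X Y} → t (toℕ i) {X} {Y}
        tⱼ  = λ {X Y} → t (toℕ j) {X} {Y}
    in begin
    π n i ∘ π n j ∘ l n ∘ Tₙ₁ n f                ≈⟨ π n i ∘⟩ assoc _ _ _ ⟨
    π n i ∘ (π n j ∘ l n) ∘ Tₙ₁ n f              ≈⟨ assoc _ _ _ ⟨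
    (π n i ∘ π n j ∘ l n) ∘ Tₙ₁ n f              ≈⟨ π-π-l n i j ⟨∘ _ ⟩
    kron (toℕ i) (toℕ j) (π n i) ∘ Tₙ₁ n f
      ≈⟨ kron-homo (toℕ i) (toℕ j) (_∘ Tₙ₁ n f) (𝟘-∘ _) _ ⟩
    kron (toℕ i) (toℕ j) (π n i ∘ Tₙ₁ n f)
      ≈⟨ kron-cong (toℕ i) (toℕ j) (λ _ → π-tuple n _ i) ⟩
    kron (toℕ i) (toℕ j) (tᵢ f ∘ sᵢ)
      ≈⟨ t-t-l n (toℕ i) (toℕ j) i≤n j≤n f ⟨
    tⱼ (tᵢ f) ∘ (Sₙ₁ (toℕ j) sᵢ ∘ sⱼ) ∘ l n      ≈⟨ _ ∘⟩ assoc _ _ _ ⟩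
    tⱼ (tᵢ f) ∘ Sₙ₁ (toℕ j) sᵢ ∘ sⱼ ∘ l n        ≈⟨ assoc _ _ _ ⟨
    (tⱼ (tᵢ f) ∘ Sₙ₁ (toℕ j) sᵢ) ∘ sⱼ ∘ l n
      -- Since `sᵢ` is linear, the functor acts on it as `Sₙ₁`, which yields the horizontal
      -- composite `s*s`.
      ≈⟨ t-∘-linear (toℕ j) (tᵢ f) (s-linear {n = n} i≤n) ⟨∘ _ ⟨
    tⱼ (tᵢ f ∘ sᵢ) ∘ sⱼ ∘ l n                    ≈⟨ t-cong (toℕ j) (π-tuple n _ i) ⟨∘ _ ⟨
    tⱼ (π n i ∘ Tₙ₁ n f) ∘ sⱼ ∘ l n              ≈⟨ π-t (toℕ j) n (Tₙ₁ n f) i ⟨∘ _ ⟨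
    (π n i ∘ tⱼ (Tₙ₁ n f)) ∘ sⱼ ∘ l n            ≈⟨ assoc _ _ _ ⟩
    π n i ∘ tⱼ (Tₙ₁ n f) ∘ sⱼ ∘ l n              ≈⟨ π n i ∘⟩ assoc _ _ _ ⟨
    π n i ∘ (tⱼ (Tₙ₁ n f) ∘ sⱼ) ∘ l n            ≈⟨ π n i ∘⟩ (π-tuple n _ j ⟨∘ l n) ⟨
    π n i ∘ (π n j ∘ Tₙ₁ n (Tₙ₁ n f)) ∘ l n      ≈⟨ π n i ∘⟩ assoc _ _ _ ⟩
    π n i ∘ π n j ∘ Tₙ₁ n (Tₙ₁ n f) ∘ l n        ∎

proposition16 : {r ℓr o ℓ e : Level} (R : CommutativeSemiring r ℓr) (inverses : IntegerInverses R)
    (𝒞 : CartesianDifferentialCategory R o ℓ e) →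
    let open HigherTangent inverses 𝒞 in
    ((n i j : ℕ) (n≥i : n ≥ i) (n≥j : n ≥ j) {X Y : Obj} (f : X ⇒ Y) →
    t j (t i f) ∘ s*s {i} {j} {n} {X} n≥j n≥i ∘ l n
    ≈ (if does (i ≟ j) then t i f ∘ s {i} {n} {X} n≥i else 𝟘))
    × ((n : ℕ) → IsNaturalTransformation (T n) (T n ∘F T n) (λ X → l n {X}))
proposition16 R inverses 𝒞 =
  (λ n i j n≥i n≥j f → t-t-l n i j n≥i n≥j f) Product., l-natural
  where open Jets inverses 𝒞
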